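{- Let $T$ be a reflexive tree and let $\phi:E(T)\to\mathbb{Z}$ be an assignment of integers to the edges of $T$ that is positive on every loop. Suppose there exist two adjacent vertices $u,v\in V(T)$ with $\phi(u)=\phi(v)=1$. Then there exists $N$ such that for every prime $p\ge N$, the covering graph $T^{\sigma}$ (with $\sigma$ the voltage assignment into $\mathbb{Z}_p$ induced by $\phi$) is Hamiltonian.
   Context: A reflexive tree is a tree with exactly one loop added at every vertex; $\phi(w)$ denotes the integer assigned to the loop at $w$. For a prime $p$, the voltage assignment $\sigma$ into $\mathbb{Z}_p$ is defined by giving each edge $e$ a fixed orientation with arcs $e^+,e^-$ (for a loop, the primary and secondary arc) and setting $\sigma(e^+)=\phi(e)\bmod p$, $\sigma(e^-)=-\phi(e)\bmod p$. The lift $T^\sigma$ has vertex set $V(T)\times\mathbb{Z}_p$, with $(x,a)$ adjacent to $(y,b)$ iff some arc $(x,y)$ has $\sigma(x,y)=b-a$. -}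

module Defs where

open import Level using (0ℓ)
open import Data.Nat using (ℕ; zero; suc; _≤_)
open import Data.Nat.Primality using (Prime)
open import Data.Fin using (Fin; zero; suc; inject₁; fromℕ; toℕ)
open import Data.Integer using (ℤ; +_; -_; _-_; _>_)
open import Data.Integer.Divisibility using () renaming (_∣_ to _∣ℤ_)
open import Data.Product using (Σ; ∃; _×_; _,_)
open import Data.Sum using (_⊎_)
open import Function.Definitions using (Injective; Surjective)
open import Relation.Binary.PropositionalEquality using (_≡_)
open import Relation.Nullary using (¬_)

data Walk {V : Set} (R : V → V → Set) : V → V → Set where
  [] : ∀ {x} → Walk R x x
  _∷_ : ∀ {x y z} → R x y → Walk R y z → Walk R x z

record IsCycle {V : Set} (R : V → V → Set) (k : ℕ) (c : Fin (suc k) → V) : Set where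
  field
    long     : 2 ≤ k
    distinct : ∀ i j → c i ≡ c j → i ≡ j
    steps    : (i : Fin k) → R (c (inject₁ i)) (c (suc i))
    closing  : R (c (fromℕ k)) (c zero)

Hamiltonian : {V : Set} → (V → V → Set) → Set
Hamiltonian {V} R =
  Σ ℕ λ k → Σ (Fin (suc k) → V) λ c → IsCycle R k c × (∀ v → ∃ λ i → c i ≡ v)

record IsTree (n : ℕ) (Adj : Fin n → Fin n → Set) : Set where
  field
    sym       : ∀ {x y} → Adj x y → Adj y x
    irrefl    : ∀ {x} → ¬ Adj x x
    connected : ∀ x y → Walk Adj x y
    acyclic   : ∀ k (c : Fin (suc k) → Fin n) → ¬ IsCycle Adj k c

-- A reflexive tree T (a tree with one loop at every vertex) together with an
-- integer assignment φ on its edges, with a fixed orientation of each tree edge.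
-- The orientation together with φ is encoded by  arcφ x y  for adjacent x y:
-- the value σ-lifts to the arc (x,y); it satisfies  arcφ y x = - arcφ x y,
-- i.e. if e is oriented e⁺ = (x,y) then arcφ x y = φ(e), arcφ y x = -φ(e).
-- loopφ w is the integer φ(w) on the loop at w.
record WeightedReflexiveTree : Set₁ where
  field
    n      : ℕ
    Adj    : Fin n → Fin n → Set
    tree   : IsTree n Adj
    arcφ   : Fin n → Fin n → ℤ
    antisym : ∀ {x y} → Adj x y → arcφ y x ≡ - arcφ x y
    loopφ  : Fin n → ℤ

_≡_[mod_] : ℤ → ℤ → ℕ → Set
a ≡ b [mod p ] = (+ p) ∣ℤ (a - b)

-- The lift T^σ for σ into ℤ_p (ℤ_p represented by Fin p):
-- (x,a) ~ (y,b) iff some arc (x,y) has σ(x,y) = b - a in ℤ_p.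
-- Arcs from x to y: the tree arc (if x,y adjacent) with voltage arcφ x y,
-- and, if x = y, the two arcs of the loop with voltages φ(x) and -φ(x).
LiftAdj : (T : WeightedReflexiveTree) (p : ℕ) →
          let open WeightedReflexiveTree T in
          Fin n × Fin p → Fin n × Fin p → Set
LiftAdj T p (x , a) (y , b) =
  (Adj x y × arcφ x y ≡ (+ toℕ b) - (+ toℕ a) [mod p ])
  ⊎ (x ≡ y × (loopφ x ≡ (+ toℕ b) - (+ toℕ a) [mod p ]
             ⊎ (- loopφ x) ≡ (+ toℕ b) - (+ toℕ a) [mod p ]))
  where open WeightedReflexiveTree T

{-# OPTIONS --safe #-}
module Submission where

-- After a change of gauge along a spanning tree the voltages of the tree edges vanish: the lift
-- consists of the cycles b ↦ b + φ(x) on the fibres of the vertices x, and of rungs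
-- (x , b) — (y , b).  These cycles have to be merged by local exchanges of loop edges for rungs.
--
-- If φ(x) = φ(w), exchanging one pair of loop edges for two rungs merges the fibres of x and w.
-- Otherwise let r = φ(x), s = φ(w) and cut the loop edges above b and b + s at x and those above
-- b and b + r at w, adding the rungs at b, b + r, b + s, b + r + s.  Over a stretch of the circle
-- the fibre of z forms φ(z) parallel strands, and such a flip joins a strand of x to one of w at
-- its lower and at its upper end, but permutes the remaining strands.  Flips at suitable heights
-- turn at the same two strands of x and w, and if they are kept apart by boxes that merge x with
-- another fibre, their permutations compose.  Repeating the flip a multiple of the order of that
-- permutation therefore merges the fibres of x and w and passes all other strands straight on.
-- The two loops with φ = 1 give the first box; the boxes for the other tree edges are obtained
-- from it going outwards along the tree.  Boxes for all tree edges at disjoint heights turn the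
-- union of the fibre cycles into a 2-regular graph, which is connected because p is prime to all
-- φ(z), that is, into a Hamiltonian cycle.

open import Defs
open import Data.Bool using (Bool; true; false; not)
open import Data.Bool.Properties using (not-involutive; not-injective; not-¬) renaming (_≟_ to _≟ᵇ_)
open import Data.Empty using (⊥; ⊥-elim)
open import Data.Fin as Fin using (Fin; zero; suc; toℕ; fromℕ<)
import Data.Fin.Properties as Finₚ
open import Data.Integer as ℤ using (ℤ)
open import Data.Integer.DivMod using (_%ℕ_; _/ℕ_; n%ℕd<d; a≡a%ℕn+[a/ℕn]*n)
import Data.Integer.Divisibility.Signed as Signed
import Data.Integer.Properties as ℤₚ
open import Data.Integer.Solver using () renaming (module +-*-Solver to ℤ-Solver)
open import Data.List using (List; []; _∷_; map; allFin)
import Data.List.Membership.DecPropositional as DecMembership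
open import Data.List.Membership.Propositional using (_∈_; _∉_; find; lose)
open import Data.List.Membership.Propositional.Properties using (∈-map⁺; ∈-allFin)
import Data.List.Relation.Unary.All as All
import Data.List.Relation.Unary.All.Properties as Allₚ
open import Data.List.Relation.Unary.Any using (here; there; any?)
open import Data.Nat hiding (_>_)
open import Data.Nat.Coprimality using (Coprime; coprime-Bézout; prime⇒coprime)
open import Data.Nat.Divisibility
open import Data.Nat.DivMod
open import Data.Nat.GCD using (module Bézout)
open import Data.Nat.ListAction using (product)
open import Data.Nat.ListAction.Properties using (∈⇒∣product; product≢0)
open import Data.Nat.Primality using (Prime; prime⇒nonZero)
open import Data.Nat.Properties
open import Data.Nat.Solver using () renaming (module +-*-Solver to ℕ-Solver)
open import Data.Product using (Σ; ∃; _×_; _,_; proj₁; proj₂)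
open import Data.Product.Properties using (≡-dec)
open import Data.Sum using (_⊎_; inj₁; inj₂)
open import Function using (_∘_; id; it; case_of_)
open import Relation.Binary.Construct.Closure.Equivalence using (EqClosure) renaming (isEquivalence to EqClosure-isEquivalence)
open import Relation.Binary.Construct.Closure.ReflexiveTransitive using (ε; _◅_)
open import Relation.Binary.Construct.Closure.Symmetric using (fwd; bwd)
import Relation.Binary.Construct.On as On
open import Relation.Binary.Definitions using (DecidableEquality; tri<; tri≈; tri>)
open import Relation.Binary.PropositionalEquality hiding (isEquivalence)
open import Relation.Binary.Structures using (IsEquivalence)
open import Relation.Nullary using (¬_; Dec; yes; no)

-- Iterates of injective self-maps of finite sets

InjectiveFn : {A B : Set} → (A → B) → Set
InjectiveFn f = ∀ {a b} → f a ≡ f b → a ≡ b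

iter : {A : Set} → (A → A) → ℕ → A → A
iter f zero    a = a
iter f (suc k) a = f (iter f k a)

module _ {A : Set} (f : A → A) where

  iter-+ : ∀ i j a → iter f (i + j) a ≡ iter f i (iter f j a)
  iter-+ zero    j a = refl
  iter-+ (suc i) j a = cong f (iter-+ i j a)

  iter-suc : ∀ k a → iter f (suc k) a ≡ iter f k (f a)
  iter-suc zero    a = refl
  iter-suc (suc k) a = cong f (iter-suc k a)

  iter-* : ∀ j k a → iter f k a ≡ a → iter f (j * k) a ≡ a
  iter-* zero    k a eq = refl
  iter-* (suc j) k a eq = trans (iter-+ k (j * k) a) (trans (cong (iter f k) (iter-* j k a eq)) eq)

  iter-∣ : ∀ k {m} a → iter f k a ≡ a → k ∣ m → iter f m a ≡ a
  iter-∣ k a eq (divides q refl) = iter-* q k a eq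

  iter-injective : InjectiveFn f → ∀ k → InjectiveFn (iter f k)
  iter-injective inj zero    eq = eq
  iter-injective inj (suc k) eq = iter-injective inj k (inj eq)

  -- By pigeonhole two of the first `N` + 1 iterates agree, and injectivity cancels their common
  -- initial applications of `f`.
  iter-returns : ∀ {N} (e : A → Fin N) → InjectiveFn e → InjectiveFn f →
                 ∀ a → ∃ λ k → 1 ≤ k × k ≤ N × iter f k a ≡ a
  iter-returns {N} e e-inj f-inj a
    with i , j , i<j , eq ← Finₚ.pigeonhole (n<1+n N) (λ i → e (iter f (toℕ i) a))
    = toℕ j ∸ toℕ i , m<n⇒0<n∸m i<j , ≤-trans (m∸n≤m (toℕ j) (toℕ i)) (s≤s⁻¹ (Finₚ.toℕ<n j)) ,
      iter-injective f-inj (toℕ i) (begin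
        iter f (toℕ i) (iter f (toℕ j ∸ toℕ i) a) ≡⟨ iter-+ (toℕ i) (toℕ j ∸ toℕ i) a ⟨
        iter f (toℕ i + (toℕ j ∸ toℕ i)) a         ≡⟨ cong (λ m → iter f m a) (m+[n∸m]≡n (<⇒≤ i<j)) ⟩
        iter f (toℕ j) a                           ≡⟨ e-inj eq ⟨
        iter f (toℕ i) a                           ∎)
    where open ≡-Reasoning

  -- Return times of different points may differ, but each is at most `N` and so divides `N !`; one
  -- exponent serves all points.
  iter-order : ∀ {N} (e : A → Fin N) → InjectiveFn e → InjectiveFn f → ∀ a → iter f (N !) a ≡ a
  iter-order {N} e e-inj f-inj a with iter-returns e e-inj f-inj a
  ... | suc k , 1≤k , k≤N , eq = iter-∣ (suc k) a eq (∣-trans (m∣m*n {suc k} (k !)) (m≤n⇒m!∣n! k≤N))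

least : {P : ℕ → Set} → (∀ k → Dec (P k)) → ∀ k → P k →
        ∃ λ m → P m × (∀ j → j < m → ¬ P j)
least {P} P? k pk = search k 0 (subst P (sym (+-identityʳ k)) pk) (λ _ ())
  where
  search : ∀ fuel s → P (fuel + s) → (∀ j → j < s → ¬ P j) → ∃ λ m → P m × (∀ j → j < m → ¬ P j)
  search zero       s ps below = s , ps , below
  search (suc fuel) s ps below with P? s
  ... | yes p = s , p , below
  ... | no ¬p = search fuel (suc s) (subst P (sym (+-suc fuel s)) ps) below′
    where
    below′ : ∀ j → j < suc s → ¬ P j
    below′ j (s≤s j≤s) with m≤n⇒m<n∨m≡n j≤s
    ... | inj₁ j<s  = below j j<s
    ... | inj₂ refl = ¬p

-- From connected 2-regular graphs to Hamiltonian cycles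

-- A connected 2-regular graph is a cycle: its darts (v , i), i one of the two slots at v, are
-- permuted by step = flip ∘ rev, and conjugation by flip inverts step, so that an orbit of step
-- cannot contain both darts at a vertex.
module TwoRegular
  {V : Set} (_≟_ : DecidableEquality V) {N : ℕ} (e : V × Bool → Fin N) (e-inj : InjectiveFn e)
  (R : V → V → Set) (nbr : V → Bool → V) (nbr-R : ∀ v i → R v (nbr v i))
  (nbr-sym : ∀ v i → ∃ λ j → nbr (nbr v i) j ≡ v)
  (nbr-distinct : ∀ v → nbr v true ≢ nbr v false)
  (nbr-irrefl : ∀ v i → nbr v i ≢ v)
  where

  Dart : Set
  Dart = V × Bool

  nbr-injective : ∀ v {i j} → nbr v i ≡ nbr v j → i ≡ j
  nbr-injective v {true}  {true}  eq = refl
  nbr-injective v {true}  {false} eq = ⊥-elim (nbr-distinct v eq)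
  nbr-injective v {false} {true}  eq = ⊥-elim (nbr-distinct v (sym eq))
  nbr-injective v {false} {false} eq = refl

  flip rev step : Dart → Dart
  flip (v , i) = v , not i
  rev (v , i) = nbr v i , proj₁ (nbr-sym v i)
  step = flip ∘ rev

  flip-involutive : ∀ d → flip (flip d) ≡ d
  flip-involutive (v , i) = cong (v ,_) (not-involutive i)

  -- The two slots at a vertex lead to different vertices, so a dart is determined by its two ends.
  dart-≡ : ∀ {v w i j} → v ≡ w → nbr v i ≡ nbr w j → (v , i) ≡ (w , j)
  dart-≡ refl eq = cong (_ ,_) (nbr-injective _ eq)

  rev-involutive : ∀ d → rev (rev d) ≡ d
  rev-involutive (v , i) =
    dart-≡ v′≡v (proj₂ (nbr-sym (nbr v i) (proj₁ (nbr-sym v i))))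
    where v′≡v = proj₂ (nbr-sym v i)

  step-flip : ∀ d → step (flip (step d)) ≡ flip d
  step-flip d = cong flip (trans (cong rev (flip-involutive (rev d))) (rev-involutive d))

  step-injective : InjectiveFn step
  step-injective {a} {b} eq = begin
    a                          ≡⟨ flip-involutive a ⟨
    flip (flip a)              ≡⟨ cong flip (step-flip a) ⟨
    flip (step (flip (step a))) ≡⟨ cong (λ d → flip (step (flip d))) eq ⟩
    flip (step (flip (step b))) ≡⟨ cong flip (step-flip b) ⟩
    flip (flip b)              ≡⟨ flip-involutive b ⟩
    b                          ∎
    where open ≡-Reasoning

  -- Descent by two: as `flip d` equals `step (flip (step d))`, cancelling one step turns a reversal
  -- of `d` in k + 2 steps into a reversal of `step d` in k steps. Zero steps would make a slot its
  -- own negation, one step would make a vertex its own neighbour.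
  not-reversing : ∀ k d → iter step k d ≢ flip d
  not-reversing zero          (v , i) eq = not-¬ {i} refl (cong proj₂ eq)
  not-reversing (suc zero)    (v , i) eq = nbr-irrefl v i (cong proj₁ eq)
  not-reversing (suc (suc k)) d       eq = not-reversing k (step d) (step-injective (begin
    step (iter step k (step d)) ≡⟨ iter-suc step (suc k) d ⟨
    iter step (suc (suc k)) d   ≡⟨ eq ⟩
    flip d                      ≡⟨ step-flip d ⟨
    step (flip (step d))        ∎))
    where open ≡-Reasoning

  _≟ᵈ_ : DecidableEquality Dart
  (v , i) ≟ᵈ (w , j) with v ≟ w | i ≟ᵇ j
  ... | yes refl | yes refl = yes refl
  ... | no v≢w   | _        = no (v≢w ∘ cong proj₁)
  ... | yes _    | no i≢j   = no (i≢j ∘ cong proj₂)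

  period : ∀ d → ∃ λ k → iter step (suc k) d ≡ d × (∀ j → j < k → iter step (suc j) d ≢ d)
  period d with iter-returns step e e-inj step-injective d
  ... | suc k , _ , _ , eq = least (λ j → iter step (suc j) d ≟ᵈ d) k eq

  Link : V → V → Set
  Link v w = ∃ λ i → nbr v i ≡ w

  module Orbit
    (v₀ : V) (k₀ : ℕ) (closes : iter step (suc k₀) (v₀ , true) ≡ (v₀ , true))
    (minimal : ∀ j → j < k₀ → iter step (suc j) (v₀ , true) ≢ (v₀ , true))
    where

    K : ℕ
    K = suc k₀

    d₀ : Dart
    d₀ = v₀ , true

    dart : ℕ → Dart
    dart k = iter step k d₀

    vert : ℕ → V
    vert = proj₁ ∘ dart

    vert-R : ∀ k → R (vert k) (vert (suc k))
    vert-R k = nbr-R (vert k) (proj₂ (dart k))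

    -- The period is `suc k` and has to be at least 3. Period 1 contradicts irreflexivity; period 2
    -- would return along the edge just used, although `step` leaves by the other slot.
    long : ∀ k → dart (suc k) ≡ d₀ → 2 ≤ k
    long zero eq = ⊥-elim (nbr-irrefl v₀ true (cong proj₁ eq))
    long (suc zero) eq = ⊥-elim (not-¬ {j} refl (sym (nbr-injective w {not j} {j} (trans (cong proj₁ eq) (sym (proj₂ (nbr-sym v₀ true)))))))
      where
      w = nbr v₀ true
      j = proj₁ (nbr-sym v₀ true)
    long (suc (suc k)) eq = s≤s (s≤s z≤n)

    -- A vertex visited twice is left either by the same slot, against the minimality of the period,
    -- or by opposite slots, which `not-reversing` excludes.
    vert-distinct< : ∀ {i j} → i < j → j < K → vert i ≢ vert j
    vert-distinct< {i} {j} i<j (s≤s j≤k₀) eq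
      with j ∸ i | m+[n∸m]≡n (<⇒≤ i<j) | m<n⇒0<n∸m i<j | m∸n≤m j i
    ... | suc m | i+sm≡j | _ | sm≤j = by-sides (proj₂ (dart i)) (proj₂ (dart j)) refl refl
      where
      dart-j : dart j ≡ iter step (suc m) (dart i)
      dart-j = trans (cong dart (trans (sym i+sm≡j) (+-comm i (suc m)))) (iter-+ step (suc m) i d₀)
      same : proj₂ (dart i) ≡ proj₂ (dart j) → ⊥
      same eq₂ = minimal m (≤-trans sm≤j j≤k₀)
        (iter-injective step step-injective i (begin
          iter step i (dart (suc m)) ≡⟨ iter-+ step i (suc m) d₀ ⟨
          dart (i + suc m)           ≡⟨ cong dart i+sm≡j ⟩
          dart j                     ≡⟨ cong₂ _,_ eq eq₂ ⟨
          dart i                     ∎))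
        where open ≡-Reasoning
      opposite : not (proj₂ (dart i)) ≡ proj₂ (dart j) → ⊥
      opposite eq₂ = not-reversing (suc m) (dart i) (trans (sym dart-j) (sym (cong₂ _,_ eq eq₂)))
      by-sides : ∀ b c → proj₂ (dart i) ≡ b → proj₂ (dart j) ≡ c → ⊥
      by-sides true  true  p q = same (trans p (sym q))
      by-sides true  false p q = opposite (trans (cong not p) (sym q))
      by-sides false true  p q = opposite (trans (cong not p) (sym q))
      by-sides false false p q = same (trans p (sym q))

    vert-distinct : ∀ {i j} → i < K → j < K → vert i ≡ vert j → i ≡ j
    vert-distinct {i} {j} i<K j<K eq with <-cmp i j
    ... | tri< i<j _ _ = ⊥-elim (vert-distinct< i<j j<K eq)
    ... | tri≈ _ i≡j _ = i≡j
    ... | tri> _ _ j<i = ⊥-elim (vert-distinct< j<i i<K (sym eq))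

    Visited : V → Set
    Visited v = ∃ λ k → vert k ≡ v

    -- The slot by which the orbit leaves leads to its next vertex, the other slot back to the
    -- previous one; at index 0 the previous vertex is the last one, `vert k₀`.
    visited-nbr : ∀ {v} → Visited v → ∀ i → Visited (nbr v i)
    visited-nbr (k , refl) i with i ≟ᵇ proj₂ (dart k)
    ... | yes refl = suc k , refl
    visited-nbr (suc k , refl) i | no i≢ = k , (begin
        vert k                                        ≡⟨ cong proj₁ (rev-involutive (dart k)) ⟨
        nbr (vert (suc k)) (proj₂ (rev (dart k)))     ≡⟨ cong (nbr (vert (suc k))) (≢-not (i≢ ∘ sym)) ⟩
        nbr (vert (suc k)) i                          ∎)
      where
      open ≡-Reasoning
      ≢-not : ∀ {b c} → not b ≢ c → b ≡ c
      ≢-not {true}  {true}  _ = refl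
      ≢-not {true}  {false} p = ⊥-elim (p refl)
      ≢-not {false} {true}  p = ⊥-elim (p refl)
      ≢-not {false} {false} _ = refl
    visited-nbr (zero , refl) false | no _ = subst (λ v → Visited (nbr v false)) (cong proj₁ closes)
      (k₀ , (begin
        vert k₀                                   ≡⟨ cong proj₁ (rev-involutive (dart k₀)) ⟨
        nbr (vert K) (proj₂ (rev (dart k₀)))      ≡⟨ cong (nbr (vert K)) (not-injective (cong proj₂ closes)) ⟩
        nbr (vert K) false                        ∎))
      where open ≡-Reasoning
    visited-nbr (zero , refl) true  | no i≢ = ⊥-elim (i≢ refl)

    visited-closed : ∀ {v w} → EqClosure Link v w → Visited v → Visited w
    visited-closed ε p = p
    visited-closed (fwd (i , refl) ◅ c) p = visited-closed c (visited-nbr p i)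
    visited-closed (_◅_ {j = w} (bwd (i , refl)) c) p =
      visited-closed c (subst Visited (proj₂ (nbr-sym w i)) (visited-nbr p (proj₁ (nbr-sym w i))))

    vert-% : ∀ k → vert (k % K) ≡ vert k
    vert-% k = cong proj₁ (begin
      dart (k % K)                          ≡⟨ cong (iter step (k % K)) (iter-* step (k / K) K d₀ closes) ⟨
      iter step (k % K) (dart (k / K * K))  ≡⟨ iter-+ step (k % K) (k / K * K) d₀ ⟨
      dart (k % K + k / K * K)              ≡⟨ cong dart (m≡m%n+[m/n]*n k K) ⟨
      dart k                                ∎)
      where open ≡-Reasoning

    orbit-hamiltonian : (∀ v → EqClosure Link v₀ v) → Hamiltonian R
    orbit-hamiltonian conn = k₀ , vert ∘ toℕ , cycle , covers
      where
      cycle : IsCycle R k₀ (vert ∘ toℕ)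
      cycle = record
        { long     = long k₀ closes
        ; distinct = λ i j eq → Finₚ.toℕ-injective (vert-distinct (Finₚ.toℕ<n i) (Finₚ.toℕ<n j) eq)
        ; steps    = λ i → subst (λ k → R (vert k) (vert (suc (toℕ i)))) (sym (Finₚ.toℕ-inject₁ i)) (vert-R (toℕ i))
        ; closing  = subst₂ R (cong vert (sym (Finₚ.toℕ-fromℕ k₀))) (cong proj₁ closes) (vert-R k₀)
        }
      covers : ∀ v → ∃ λ i → vert (toℕ i) ≡ v
      covers v with visited-closed (conn v) (0 , refl)
      ... | k , refl = fromℕ< (m%n<n k K) , trans (cong vert (Finₚ.toℕ-fromℕ< (m%n<n k K))) (vert-% k)

  connected⇒hamiltonian : ∀ v₀ → (∀ v → EqClosure Link v₀ v) → Hamiltonian R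
  connected⇒hamiltonian v₀ conn with period (v₀ , true)
  ... | k₀ , closes , minimal = Orbit.orbit-hamiltonian v₀ k₀ closes minimal conn

-- Transpositions and cancellation of residues

module Transposition {A : Set} (_≟_ : DecidableEquality A) where

  swap : A → A → A → A
  swap a b c with c ≟ a | c ≟ b
  ... | yes _ | _     = b
  ... | no _  | yes _ = a
  ... | no _  | no _  = c

  swap-left : ∀ a b → swap a b a ≡ b
  swap-left a b with a ≟ a
  ... | yes _ = refl
  ... | no ¬p = ⊥-elim (¬p refl)

  swap-right : ∀ a b → swap a b b ≡ a
  swap-right a b with b ≟ a | b ≟ b
  ... | yes b≡a | _     = b≡a
  ... | no _    | yes _ = refl
  ... | no _    | no ¬p = ⊥-elim (¬p refl)

  swap-other : ∀ {a b c} → c ≢ a → c ≢ b → swap a b c ≡ c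
  swap-other {a} {b} {c} c≢a c≢b with c ≟ a | c ≟ b
  ... | yes p | _     = ⊥-elim (c≢a p)
  ... | no _  | yes p = ⊥-elim (c≢b p)
  ... | no _  | no _  = refl

  swap-involutive : ∀ a b c → swap a b (swap a b c) ≡ c
  swap-involutive a b c = by-cases (c ≟ a) (c ≟ b)
    where
    by-cases : Dec (c ≡ a) → Dec (c ≡ b) → swap a b (swap a b c) ≡ c
    by-cases (yes refl) _ = trans (cong (swap a b) (swap-left a b)) (swap-right a b)
    by-cases (no _) (yes refl) = trans (cong (swap a b) (swap-right a b)) (swap-left a b)
    by-cases (no p) (no q) = trans (cong (swap a b) (swap-other p q)) (swap-other p q)

  swap-injective : ∀ a b → InjectiveFn (swap a b)
  swap-injective a b {c} {d} eq =
    trans (sym (swap-involutive a b c)) (trans (cong (swap a b) eq) (swap-involutive a b d))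

-- Adding `l * pred d` undoes the addition of `l` modulo `d`, as both together add `l * d`.
+-cancel-% : ∀ d l a b .{{_ : NonZero d}} → (l + a) % d ≡ (l + b) % d → a % d ≡ b % d
+-cancel-% d l a b eq = begin
  a % d                            ≡⟨ shift a ⟩
  ((l + a) % d + (l * pred d) % d) % d ≡⟨ cong (λ m → (m + (l * pred d) % d) % d) eq ⟩
  ((l + b) % d + (l * pred d) % d) % d ≡⟨ shift b ⟨
  b % d                            ∎
  where
  open ≡-Reasoning
  l*d : l + l * pred d ≡ l * d
  l*d = trans (sym (*-suc l (pred d))) (cong (l *_) (suc-pred d))
  shift : ∀ c → c % d ≡ ((l + c) % d + (l * pred d) % d) % d
  shift c = begin
    c % d                              ≡⟨ [m+kn]%n≡m%n c l d ⟨
    (c + l * d) % d                    ≡⟨ cong (λ m → (c + m) % d) l*d ⟨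
    (c + (l + l * pred d)) % d         ≡⟨ cong (_% d) (trans (sym (+-assoc c l _)) (cong (_+ l * pred d) (+-comm c l))) ⟩
    ((l + c) + l * pred d) % d         ≡⟨ %-distribˡ-+ (l + c) (l * pred d) d ⟩
    ((l + c) % d + (l * pred d) % d) % d ∎

-- Strands of the fibres and composition of tangles

module Strands {n : ℕ} (κ : Fin n → ℕ) where

  φ : Fin n → ℕ
  φ z = suc (κ z)

  -- Heights are natural numbers: the circle of residues modulo p is unrolled, and `project` closes
  -- it up later.
  Node : Set
  Node = Fin n × ℕ

  Strand : Set
  Strand = Σ (Fin n) (Fin ∘ φ)

  -- Loop edges at `z` shift by `φ z`, so the `φ z` heights from `h` upwards contain one node of
  -- each strand. Labels are thus relative to a reference height.
  at : ℕ → Strand → Node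
  at h (z , i) = z , h + toℕ i

  strand : Fin n → ℕ → Strand
  strand z d = z , d mod φ z

  origin : Fin n → Strand
  origin z = z , zero

  at-strand : ∀ h z d → at h (strand z d) ≡ (z , h + d % φ z)
  at-strand h z d = cong (λ m → z , h + m) (Finₚ.toℕ-fromℕ< (m%n<n d (φ z)))

  strand-≡ : ∀ z d e → d % φ z ≡ e % φ z → strand z d ≡ strand z e
  strand-≡ z d e eq = cong (z ,_) (Finₚ.fromℕ<-cong _ _ eq (m%n<n d (φ z)) (m%n<n e (φ z)))

  strand-toℕ : ∀ z i → strand z (toℕ i) ≡ (z , i)
  strand-toℕ z i = cong (z ,_) (Finₚ.toℕ-injective
    (trans (Finₚ.toℕ-fromℕ< (m%n<n (toℕ i) (φ z))) (m<n⇒m%n≡m (Finₚ.toℕ<n i))))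

  strand-injective : ∀ z d e → strand z d ≡ strand z e → d % φ z ≡ e % φ z
  strand-injective z d e eq = trans (sym (Finₚ.toℕ-fromℕ< (m%n<n d (φ z))))
    (trans (index-cong eq) (Finₚ.toℕ-fromℕ< (m%n<n e (φ z))))
    where
    index : Strand → ℕ
    index (_ , i) = toℕ i
    index-cong : ∀ {σ τ} → σ ≡ τ → index σ ≡ index τ
    index-cong refl = refl

  _≟ˢ_ : DecidableEquality Strand
  (y , i) ≟ˢ (z , j) with y Fin.≟ z
  ... | no y≢z = no (y≢z ∘ cong proj₁)
  ... | yes refl with i Fin.≟ j
  ...   | yes refl = yes refl
  ...   | no i≢j = no λ { refl → i≢j refl }

  -- A common multiple of all loop values: along loop edges over a distance divisible by it, every
  -- strand keeps its label. It also bounds every loop value.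
  Λ : ℕ
  Λ = product (map φ (allFin n))

  φ∣Λ : ∀ z → φ z ∣ Λ
  φ∣Λ z = ∈⇒∣product (∈-map⁺ φ (∈-allFin z))

  instance
    Λ-nonZero : NonZero Λ
    Λ-nonZero = product≢0 (Allₚ.map⁺ (All.universal (λ _ → _) (allFin n)))

  φ≤Λ : ∀ z → φ z ≤ Λ
  φ≤Λ z = ∣⇒≤ (φ∣Λ z)

  strandIndex : Strand → Fin (n * Λ)
  strandIndex (z , i) = Fin.combine z (Fin.inject≤ i (φ≤Λ z))

  strandIndex-injective : InjectiveFn strandIndex
  strandIndex-injective {y , i} {z , j} eq
    with Finₚ.combine-injective y (Fin.inject≤ i (φ≤Λ y)) z (Fin.inject≤ j (φ≤Λ z)) eq
  ... | refl , eq′ = cong (y ,_) (Finₚ.inject≤-injective _ _ i j eq′)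

  -- Labels being relative to the height, a strand followed down loop edges from `h + l` to `h`
  -- changes its label by `l`.
  straight : ℕ → Strand → Strand
  straight l (z , i) = strand z (l + toℕ i)

  straight-injective : ∀ l → InjectiveFn (straight l)
  straight-injective l {y , i} {z , j} eq with cong proj₁ eq
  ... | refl = begin
    y , i              ≡⟨ strand-toℕ y i ⟨
    strand y (toℕ i)   ≡⟨ strand-≡ y (toℕ i) (toℕ j) (+-cancel-% (φ y) l (toℕ i) (toℕ j) (strand-injective y (l + toℕ i) (l + toℕ j) eq)) ⟩
    strand y (toℕ j)   ≡⟨ strand-toℕ y j ⟩
    y , j              ∎
    where open ≡-Reasoning

  -- A stretch of the graph between heights h and h′ in which the strands at x and at w through
  -- the origins turn back into each other at both ends, while every other strand σ arriving at
  -- the top comes from the strand f σ at the bottom.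
  record Tangle (_≈_ : Node → Node → Set) (x w : Fin n) (f : Strand → Strand) (h h′ : ℕ) : Set where
    field
      cap     : at h (origin x) ≈ at h (origin w)
      cup     : at h′ (origin x) ≈ at h′ (origin w)
      through : ∀ σ → σ ≢ origin x → σ ≢ origin w → at h′ σ ≈ at h (f σ)
      cover   : ∀ z b → h ≤ b → b < h′ → ∃ λ σ → (z , b) ≈ at h σ ⊎ (z , b) ≈ at h′ σ

  module _ {_≈_ : Node → Node → Set} (isEq : IsEquivalence _≈_) where

    open IsEquivalence isEq renaming (refl to ≈-refl; sym to ≈-sym; trans to ≈-trans; reflexive to ≈-reflexive)

    tangle-sym : ∀ {x w f h h′} → Tangle _≈_ x w f h h′ → Tangle _≈_ w x f h h′
    tangle-sym t = record
      { cap = ≈-sym cap ; cup = ≈-sym cup ; through = λ σ p q → through σ q p ; cover = cover }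
      where open Tangle t

    tangle-cong : ∀ {x w f g h h′} → (∀ σ → f σ ≡ g σ) → Tangle _≈_ x w f h h′ → Tangle _≈_ x w g h h′
    tangle-cong {h = h} f≗g t = record
      { cap = cap ; cup = cup
      ; through = λ σ p q → ≈-trans (through σ p q) (≈-reflexive (cong (at h) (f≗g σ)))
      ; cover = cover }
      where open Tangle t

    -- The tangle between z and x in the middle keeps the turn at the top of the lower tangle
    -- and the turn at the bottom of the upper one from closing up into a cycle.
    tangle-compose : ∀ {x w z f g h₀ h₁ h₂ h₃} → z ≢ x → z ≢ w → x ≢ w →
      InjectiveFn g → g (origin x) ≡ origin x → g (origin w) ≡ origin w →
      Tangle _≈_ x w f h₀ h₁ → Tangle _≈_ z x id h₁ h₂ → Tangle _≈_ x w g h₂ h₃ →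
      Tangle _≈_ x w (f ∘ g) h₀ h₃
    tangle-compose {x} {w} {z} {f} {g} {h₀} {h₁} {h₂} {h₃} z≢x z≢w x≢w g-inj gx gw t₁ t₂ t₃ = record
      { cap     = T₁.cap
      ; cup     = T₃.cup
      ; through = λ σ p q → ≈-trans (T₃.through σ p q)
                    (pass (g σ) (λ e → p (g-inj (trans e (sym gx)))) (λ e → q (g-inj (trans e (sym gw)))))
      ; cover   = covered
      }
      where
      module T₁ = Tangle t₁
      module T₂ = Tangle t₂
      module T₃ = Tangle t₃
      X = origin x
      W = origin w
      Z = origin z
      Z≢X : Z ≢ X
      Z≢X = z≢x ∘ cong proj₁
      Z≢W : Z ≢ W
      Z≢W = z≢w ∘ cong proj₁
      W≢X : W ≢ X
      W≢X = x≢w ∘ sym ∘ cong proj₁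
      -- The strand of `z` crosses the middle tangle on a detour: over its cup to `x`, over the cap
      -- above to `w`, through the middle down to `h₁`, over the cup below to `x`, and over the cap
      -- of the middle tangle back to `z`.
      middle : at h₂ Z ≈ at h₁ Z
      middle = ≈-trans T₂.cup (≈-trans T₃.cap (≈-trans (T₂.through W (Z≢W ∘ sym) W≢X)
                 (≈-trans (≈-sym T₁.cup) (≈-sym T₂.cap))))
      pass₂ : ∀ τ → τ ≢ X → at h₂ τ ≈ at h₁ τ
      pass₂ τ τ≢X with τ ≟ˢ Z
      ... | yes refl = middle
      ... | no τ≢Z   = T₂.through τ τ≢Z τ≢X
      pass : ∀ τ → τ ≢ X → τ ≢ W → at h₂ τ ≈ at h₀ (f τ)
      pass τ τ≢X τ≢W = ≈-trans (pass₂ τ τ≢X) (T₁.through τ τ≢X τ≢W)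
      -- At `h₁` the turning strands of `x` and `w` are joined to the strand of `z`, which the lower
      -- tangle leads down.
      down₁ : ∀ τ → ∃ λ σ → at h₁ τ ≈ at h₀ σ
      down₁ τ with τ ≟ˢ X | τ ≟ˢ W
      ... | yes refl | _        = f Z , ≈-trans (≈-sym T₂.cap) (T₁.through Z Z≢X Z≢W)
      ... | no _     | yes refl = f Z , ≈-trans (≈-sym T₁.cup) (≈-trans (≈-sym T₂.cap) (T₁.through Z Z≢X Z≢W))
      ... | no τ≢X   | no τ≢W   = f τ , T₁.through τ τ≢X τ≢W
      down₂ : ∀ τ → ∃ λ σ → at h₂ τ ≈ at h₀ σ
      down₂ τ with τ ≟ˢ X
      ... | yes refl = let σ , p = down₁ Z in σ , ≈-trans (≈-sym T₂.cup) (≈-trans middle p)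
      ... | no τ≢X   = let σ , p = down₁ τ in σ , ≈-trans (pass₂ τ τ≢X) p
      covered : ∀ y b → h₀ ≤ b → b < h₃ → ∃ λ σ → (y , b) ≈ at h₀ σ ⊎ (y , b) ≈ at h₃ σ
      covered y b h₀≤b b<h₃ with b <? h₁ | b <? h₂
      ... | yes b<h₁ | _ with T₁.cover y b h₀≤b b<h₁
      ...   | σ , inj₁ p = σ , inj₁ p
      ...   | τ , inj₂ p = let σ , q = down₁ τ in σ , inj₁ (≈-trans p q)
      covered y b h₀≤b b<h₃ | no b≮h₁ | yes b<h₂ with T₂.cover y b (≮⇒≥ b≮h₁) b<h₂
      ...   | τ , inj₁ p = let σ , q = down₁ τ in σ , inj₁ (≈-trans p q)
      ...   | τ , inj₂ p = let σ , q = down₂ τ in σ , inj₁ (≈-trans p q)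
      covered y b h₀≤b b<h₃ | no _ | no b≮h₂ with T₃.cover y b (≮⇒≥ b≮h₂) b<h₃
      ...   | τ , inj₁ p = let σ , q = down₂ τ in σ , inj₁ (≈-trans p q)
      ...   | σ , inj₂ p = σ , inj₂ p

    -- Loop edges are demanded only within the range and the residue class of the climb; callers
    -- show that the removed edges miss one of the two.
    climb : ∀ h z {e d} → e ≤ d → e % φ z ≡ d % φ z →
      (∀ c → e ≤ c → c + φ z ≤ d → c % φ z ≡ e % φ z → (z , h + c) ≈ (z , h + (c + φ z))) →
      (z , h + e) ≈ (z , h + d)
    climb h z {e} {d} e≤d eq step =
      subst (λ m → (z , h + e) ≈ (z , h + m)) e+j*φ≡d (go j ≤-refl)
      where
      r = φ z
      j = d / r ∸ e / r
      e+j*φ≡d : e + j * r ≡ d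
      e+j*φ≡d = begin
        e + j * r                         ≡⟨ cong (_+ j * r) (m≡m%n+[m/n]*n e r) ⟩
        e % r + e / r * r + j * r         ≡⟨ +-assoc (e % r) _ _ ⟩
        e % r + (e / r * r + j * r)       ≡⟨ cong₂ _+_ eq (sym (*-distribʳ-+ r (e / r) j)) ⟩
        d % r + (e / r + j) * r           ≡⟨ cong (λ m → d % r + m * r) (m+[n∸m]≡n (/-monoˡ-≤ r e≤d)) ⟩
        d % r + d / r * r                 ≡⟨ m≡m%n+[m/n]*n d r ⟨
        d                                 ∎
        where open ≡-Reasoning
      next : ∀ i → e + suc i * r ≡ e + i * r + r
      next i = trans (cong (e +_) (+-comm r (i * r))) (sym (+-assoc e (i * r) r))
      go : ∀ i → i ≤ j → (z , h + e) ≈ (z , h + (e + i * r))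
      go zero    _   = ≈-reflexive (cong (λ m → z , h + m) (sym (+-identityʳ e)))
      go (suc i) i<j = ≈-trans (go i (<⇒≤ i<j)) (≈-trans
        (step (e + i * r) (m≤m+n e _) bound ([m+kn]%n≡m%n e i r))
        (≈-reflexive (cong (λ m → z , h + m) (sym (next i)))))
        where
        bound : e + i * r + r ≤ d
        bound = begin
          e + i * r + r ≡⟨ next i ⟨
          e + suc i * r ≤⟨ +-monoʳ-≤ e (*-monoˡ-≤ r i<j) ⟩
          e + j * r     ≡⟨ e+j*φ≡d ⟩
          d             ∎
          where open ≤-Reasoning

-- Boxes: local exchanges of loop edges for rungs

module Boxes {n : ℕ} (κ : Fin n → ℕ) (G : Fin n → Fin n → Set)
  (G-sym : ∀ {x y} → G x y → G y x) (G-irrefl : ∀ {x} → ¬ G x x) where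

  open Strands κ

  -- How the 2-factor passes through (x , d): along both loop edges, or along a tree edge to y
  -- and the loop edge below (top) or above (bot).
  data Status : Set where
    free    : Status
    top bot : Fin n → Status

  Rung : Status → Fin n → Set
  Rung s y = s ≡ top y ⊎ s ≡ bot y

  -- `top-bot` and `bot-top` pair the two ends of each removed loop edge. Both ends lie below `len`,
  -- so boxes can be stacked without interfering.
  record Box : Set where
    field
      len     : ℕ
      loc     : Fin n → ℕ → Status
      top-bot : ∀ x d {y} → loc x d ≡ top y → d + φ x < len × loc x (d + φ x) ≡ bot y
      bot-top : ∀ x d {y} → loc x d ≡ bot y → ∃ λ c → d ≡ c + φ x × loc x c ≡ top y
      rung    : ∀ x d {y} → Rung (loc x d) y → G x y × Rung (loc y d) x

  -- The relation stands for connectedness in the 2-factor; kept arbitrary, it allows boxes to be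
  -- analysed before that graph is built.
  record Realises (_≈_ : Node → Node → Set) (B : Box) (h : ℕ) : Set where
    open Box B
    field
      loop-edge : ∀ x d → d < len → (∀ y → loc x d ≢ top y) → (x , h + d) ≈ (x , h + (d + φ x))
      rung-edge : ∀ x d {y} → d < len → Rung (loc x d) y → (x , h + d) ≈ (y , h + d)

  module _ (A B : Box) where

    private
      module A = Box A
      module B = Box B

    seqLoc : Fin n → ℕ → Status
    seqLoc x d with d <? A.len
    ... | yes _ = A.loc x d
    ... | no  _ = B.loc x (d ∸ A.len)

    seqLoc-low : ∀ x {d} → d < A.len → seqLoc x d ≡ A.loc x d
    seqLoc-low x {d} d< with d <? A.len
    ... | yes _ = refl
    ... | no d≮ = ⊥-elim (d≮ d<)

    seqLoc-high : ∀ x d → seqLoc x (A.len + d) ≡ B.loc x d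
    seqLoc-high x d with A.len + d <? A.len
    ... | yes p = ⊥-elim (m+n≮m A.len d p)
    ... | no _  = cong (B.loc x) (m+n∸m≡n A.len d)

    data Part : ℕ → Set where
      low  : ∀ {d} → d < A.len → Part d
      high : ∀ d → Part (A.len + d)

    part : ∀ d → Part d
    part d with d <? A.len
    ... | yes p = low p
    ... | no ¬p = subst Part (m+[n∸m]≡n (≮⇒≥ ¬p)) (high (d ∸ A.len))

    seq : Box
    seq = record
      { len     = A.len + B.len
      ; loc     = seqLoc
      ; top-bot = λ x d → top-bot x (part d)
      ; bot-top = λ x d → bot-top x (part d)
      ; rung    = λ x d → rung x (part d)
      }
      where
      top-bot : ∀ x {d} → Part d → ∀ {y} → seqLoc x d ≡ top y →
                d + φ x < A.len + B.len × seqLoc x (d + φ x) ≡ bot y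
      top-bot x {d} (low p) eq with A.top-bot x d (trans (sym (seqLoc-low x p)) eq)
      ... | q , eq′ = ≤-trans q (m≤m+n A.len B.len) , trans (seqLoc-low x q) eq′
      top-bot x (high d) eq with B.top-bot x d (trans (sym (seqLoc-high x d)) eq)
      ... | q , eq′ rewrite +-assoc A.len d (φ x) = +-monoʳ-< A.len q , trans (seqLoc-high x (d + φ x)) eq′
      bot-top : ∀ x {d} → Part d → ∀ {y} → seqLoc x d ≡ bot y → ∃ λ c → d ≡ c + φ x × seqLoc x c ≡ top y
      bot-top x {d} (low p) eq with A.bot-top x d (trans (sym (seqLoc-low x p)) eq)
      ... | c , refl , eq′ = c , refl , trans (seqLoc-low x (≤-trans (s≤s (m≤m+n c (φ x))) p)) eq′
      bot-top x (high d) eq with B.bot-top x d (trans (sym (seqLoc-high x d)) eq)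
      ... | c , refl , eq′ = A.len + c , sym (+-assoc A.len c (φ x)) , trans (seqLoc-high x c) eq′
      rung : ∀ x {d} → Part d → ∀ {y} → Rung (seqLoc x d) y → G x y × Rung (seqLoc y d) x
      rung x {d} (low p) {y} ρ with A.rung x d (subst (λ s → Rung s y) (seqLoc-low x p) ρ)
      ... | g , ρ′ = g , subst (λ s → Rung s x) (sym (seqLoc-low y p)) ρ′
      rung x (high d) {y} ρ with B.rung x d (subst (λ s → Rung s y) (seqLoc-high x d) ρ)
      ... | g , ρ′ = g , subst (λ s → Rung s x) (sym (seqLoc-high y d)) ρ′

    realises-low : ∀ {_≈_ h} → Realises _≈_ seq h → Realises _≈_ A h
    realises-low r = record
      { loop-edge = λ x d d< ¬top → loop-edge x d (≤-trans d< (m≤m+n A.len B.len))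
                      (λ y eq → ¬top y (trans (sym (seqLoc-low x d<)) eq))
      ; rung-edge = λ x d {y} d< ρ → rung-edge x d (≤-trans d< (m≤m+n A.len B.len))
                      (subst (λ s → Rung s y) (sym (seqLoc-low x d<)) ρ)
      }
      where open Realises r

    realises-high : ∀ {_≈_ h} → Realises _≈_ seq h → Realises _≈_ B (h + A.len)
    realises-high {_≈_} {h} r = record
      { loop-edge = λ x d d< ¬top → subst₂ (λ a b → (x , a) ≈ (x , b))
                      (sym (+-assoc h A.len d))
                      (trans (cong (h +_) (+-assoc A.len d (φ x))) (sym (+-assoc h A.len (d + φ x))))
                      (loop-edge x (A.len + d) (+-monoʳ-< A.len d<)
                        (λ y eq → ¬top y (trans (sym (seqLoc-high x d)) eq)))
      ; rung-edge = λ x d {y} d< ρ → subst (λ a → (x , a) ≈ (y , a)) (sym (+-assoc h A.len d))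
                      (rung-edge x (A.len + d) (+-monoʳ-< A.len d<)
                        (subst (λ s → Rung s y) (sym (seqLoc-high x d)) ρ))
      }
      where open Realises r

  -- All relations and heights are allowed, so a box acts in the same way wherever it is placed in a
  -- stack.
  Acts : Box → Fin n → Fin n → (Strand → Strand) → Set₁
  Acts B x w f = ∀ {_≈_} → IsEquivalence _≈_ → ∀ h → Realises _≈_ B h → Tangle _≈_ x w f h (h + Box.len B)

  alternate : Box → Box → ℕ → Box
  alternate B E zero    = B
  alternate B E (suc m) = seq B (seq E (alternate B E m))

  alternate-acts : ∀ {B E x w z f} → z ≢ x → z ≢ w → x ≢ w →
    InjectiveFn f → f (origin x) ≡ origin x → f (origin w) ≡ origin w →
    Acts B x w f → Acts E z x id → ∀ m → Acts (alternate B E m) x w (iter f (suc m))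
  alternate-acts _ _ _ _ _ _ actB actE zero = actB
  alternate-acts {B} {E} {x} {w} {z} {f} z≢x z≢w x≢w f-inj fx fw actB actE (suc m) {_≈_} isEq h r =
    subst (Tangle _≈_ x w (iter f (suc (suc m))) h) height
      (tangle-compose isEq z≢x z≢w x≢w (iter-injective f f-inj (suc m)) (fixed fx) (fixed fw)
        (actB isEq h (realises-low B rest r))
        (actE isEq (h + Box.len B) (realises-low E (alternate B E m) r′))
        (alternate-acts z≢x z≢w x≢w f-inj fx fw actB actE m isEq _ (realises-high E (alternate B E m) r′)))
    where
    rest = seq E (alternate B E m)
    r′ = realises-high B rest r
    height : h + Box.len B + Box.len E + Box.len (alternate B E m) ≡ h + (Box.len B + (Box.len E + Box.len (alternate B E m)))
    height = trans (+-assoc (h + Box.len B) (Box.len E) _) (+-assoc h (Box.len B) _)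
    fixed : ∀ {σ} → f σ ≡ σ → iter f (suc m) σ ≡ σ
    fixed {σ} eq = subst (λ k → iter f k σ ≡ σ) (*-identityʳ (suc m)) (iter-* f (suc m) 1 σ eq)

  alternate-∣ : ∀ {k} B E m → k ∣ suc m * Box.len B → k ∣ Box.len E → k ∣ Box.len (alternate B E m)
  alternate-∣ {k} B E m p q = subst (k ∣_) (sym (length m)) (∣m∣n⇒∣m+n p (∣n⇒∣m*n m q))
    where
    open ℕ-Solver
    length : ∀ m → Box.len (alternate B E m) ≡ suc m * Box.len B + m * Box.len E
    length zero    = solve 2 (λ b e → b := con 1 :* b :+ con 0 :* e) refl (Box.len B) (Box.len E)
    length (suc m) = trans (cong (λ l → Box.len B + (Box.len E + l)) (length m))
      (solve 4 (λ b e m₁ m₂ → b :+ (e :+ (m₁ :+ m₂)) := b :+ m₁ :+ (e :+ m₂)) refl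
        (Box.len B) (Box.len E) (suc m * Box.len B) (m * Box.len E))

  -- A box merging the cycle of the fibre of x with that of w and passing all other strands on.
  record Joiner (x w : Fin n) : Set₁ where
    field
      box   : Box
      acts  : Acts box x w id
      Λ∣len : Λ ∣ Box.len box

  joiner-sym : ∀ {x w} → Joiner x w → Joiner w x
  joiner-sym j = record { box = box ; acts = λ isEq h r → tangle-sym isEq (acts isEq h r) ; Λ∣len = Λ∣len }
    where open Joiner j

-- Flips between two adjacent fibres

open DecMembership _≟_ using () renaming (_∈?_ to _∈ℕ?_)

module Flips {n : ℕ} (κ : Fin n → ℕ) (G : Fin n → Fin n → Set)
  (G-sym : ∀ {x y} → G x y → G y x) (G-irrefl : ∀ {x} → ¬ G x x) where

  open Strands κ
  open Boxes κ G G-sym G-irrefl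

  -- No upper end of a removed edge is the lower end of one: no node loses both its loop edges, and
  -- its status is unambiguous.
  Disjoint : List ℕ → ℕ → Set
  Disjoint C r = ∀ {c d} → c ∈ C → d ∈ C → c ≢ d + r

  -- d is an end of one of the removed loop edges c — c + r, c ∈ C.
  End : List ℕ → ℕ → ℕ → Set
  End C r d = d ∈ C ⊎ ∃ λ c → c ∈ C × d ≡ c + r

  module _ (C : List ℕ) (r : ℕ) (y : Fin n) where

    status : ℕ → Status
    status d with d ∈ℕ? C | any? (λ c → d ≟ c + r) C
    ... | yes _ | _     = top y
    ... | no _  | yes _ = bot y
    ... | no _  | no _  = free

    status-top : ∀ {d} → d ∈ C → status d ≡ top y
    status-top {d} p with d ∈ℕ? C
    ... | yes _ = refl
    ... | no ¬p = ⊥-elim (¬p p)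

    status-bot : Disjoint C r → ∀ {c} → c ∈ C → status (c + r) ≡ bot y
    status-bot disj {c} p with c + r ∈ℕ? C | any? (λ c′ → c + r ≟ c′ + r) C
    ... | yes q | _     = ⊥-elim (disj q p refl)
    ... | no _  | yes _ = refl
    ... | no _  | no ¬q = ⊥-elim (¬q (lose p refl))

    status-top⁻¹ : ∀ {d y′} → status d ≡ top y′ → d ∈ C × y ≡ y′
    status-top⁻¹ {d} eq with d ∈ℕ? C | any? (λ c → d ≟ c + r) C
    status-top⁻¹ refl | yes p | _     = p , refl
    status-top⁻¹ ()   | no _  | yes _
    status-top⁻¹ ()   | no _  | no _

    status-bot⁻¹ : ∀ {d y′} → status d ≡ bot y′ → (∃ λ c → c ∈ C × d ≡ c + r) × y ≡ y′
    status-bot⁻¹ {d} eq with d ∈ℕ? C | any? (λ c → d ≟ c + r) C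
    status-bot⁻¹ ()   | yes _ | _
    status-bot⁻¹ refl | no _  | yes p = find p , refl
    status-bot⁻¹ ()   | no _  | no _

    status-rung : Disjoint C r → ∀ {d} → End C r d → Rung (status d) y
    status-rung disj (inj₁ p)              = inj₁ (status-top p)
    status-rung disj (inj₂ (c , p , refl)) = inj₂ (status-bot disj p)

    status-rung⁻¹ : ∀ {d y′} → Rung (status d) y′ → End C r d × y ≡ y′
    status-rung⁻¹ (inj₁ eq) = let p , q = status-top⁻¹ eq in inj₁ p , q
    status-rung⁻¹ (inj₂ eq) = let p , q = status-bot⁻¹ eq in inj₂ p , q

  -- A rung is added at every end of a removed edge, so `endsˣ` and `endsʷ` ask that the edges
  -- removed from the two fibres have their ends at the same heights.
  module Flip {x w : Fin n} (Gxw : G x w) (C D : List ℕ) (l : ℕ)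
    (disjˣ : Disjoint C (φ x)) (disjʷ : Disjoint D (φ w))
    (endsˣ : ∀ {d} → End C (φ x) d → End D (φ w) d) (endsʷ : ∀ {d} → End D (φ w) d → End C (φ x) d)
    (boundˣ : ∀ {c} → c ∈ C → c + φ x < l) (boundʷ : ∀ {d} → d ∈ D → d + φ w < l)
    where

    x≢w : x ≢ w
    x≢w refl = G-irrefl Gxw

    statusˣ statusʷ : ℕ → Status
    statusˣ = status C (φ x) w
    statusʷ = status D (φ w) x

    flipLoc : Fin n → ℕ → Status
    flipLoc z d with z Fin.≟ x | z Fin.≟ w
    ... | yes _ | _     = statusˣ d
    ... | no _  | yes _ = statusʷ d
    ... | no _  | no _  = free

    flipLoc-x : ∀ d → flipLoc x d ≡ statusˣ d
    flipLoc-x d with x Fin.≟ x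
    ... | yes _ = refl
    ... | no ¬p = ⊥-elim (¬p refl)

    flipLoc-w : ∀ d → flipLoc w d ≡ statusʷ d
    flipLoc-w d with w Fin.≟ x | w Fin.≟ w
    ... | yes p | _     = ⊥-elim (x≢w (sym p))
    ... | no _  | yes _ = refl
    ... | no _  | no ¬p = ⊥-elim (¬p refl)

    flipLoc-other : ∀ {z} d → z ≢ x → z ≢ w → flipLoc z d ≡ free
    flipLoc-other {z} d z≢x z≢w with z Fin.≟ x | z Fin.≟ w
    ... | yes p | _     = ⊥-elim (z≢x p)
    ... | no _  | yes p = ⊥-elim (z≢w p)
    ... | no _  | no _  = refl

    data Which : Fin n → Set where
      is-x  : Which x
      is-w  : Which w
      other : ∀ {z} → z ≢ x → z ≢ w → Which z

    which : ∀ z → Which z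
    which z with z Fin.≟ x | z Fin.≟ w
    ... | yes refl | _        = is-x
    ... | no _     | yes refl = is-w
    ... | no z≢x   | no z≢w   = other z≢x z≢w

    flip : Box
    flip = record
      { len     = l
      ; loc     = flipLoc
      ; top-bot = λ z d → top-bot (which z) d
      ; bot-top = λ z d → bot-top (which z) d
      ; rung    = λ z d → rung (which z) d
      }
      where
      top-bot : ∀ {z} → Which z → ∀ d {y} → flipLoc z d ≡ top y → d + φ z < l × flipLoc z (d + φ z) ≡ bot y
      top-bot is-x d eq with status-top⁻¹ C (φ x) w (trans (sym (flipLoc-x d)) eq)
      ... | p , refl = boundˣ p , trans (flipLoc-x _) (status-bot C (φ x) w disjˣ p)
      top-bot is-w d eq with status-top⁻¹ D (φ w) x (trans (sym (flipLoc-w d)) eq)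
      ... | p , refl = boundʷ p , trans (flipLoc-w _) (status-bot D (φ w) x disjʷ p)
      top-bot (other p q) d eq with () ← trans (sym (flipLoc-other d p q)) eq
      bot-top : ∀ {z} → Which z → ∀ d {y} → flipLoc z d ≡ bot y → ∃ λ c → d ≡ c + φ z × flipLoc z c ≡ top y
      bot-top is-x d eq with status-bot⁻¹ C (φ x) w (trans (sym (flipLoc-x d)) eq)
      ... | (c , p , refl) , refl = c , refl , trans (flipLoc-x _) (status-top C (φ x) w p)
      bot-top is-w d eq with status-bot⁻¹ D (φ w) x (trans (sym (flipLoc-w d)) eq)
      ... | (c , p , refl) , refl = c , refl , trans (flipLoc-w _) (status-top D (φ w) x p)
      bot-top (other p q) d eq with () ← trans (sym (flipLoc-other d p q)) eq
      rung : ∀ {z} → Which z → ∀ d {y} → Rung (flipLoc z d) y → G z y × Rung (flipLoc y d) z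
      rung is-x d ρ with status-rung⁻¹ C (φ x) w (subst (λ s → Rung s _) (flipLoc-x d) ρ)
      ... | e , refl = Gxw , subst (λ s → Rung s x) (sym (flipLoc-w d)) (status-rung D (φ w) x disjʷ (endsˣ e))
      rung is-w d ρ with status-rung⁻¹ D (φ w) x (subst (λ s → Rung s _) (flipLoc-w d) ρ)
      ... | e , refl = G-sym Gxw , subst (λ s → Rung s w) (sym (flipLoc-x d)) (status-rung C (φ x) w disjˣ (endsʷ e))
      rung (other p q) d (inj₁ eq) with () ← trans (sym (flipLoc-other d p q)) eq
      rung (other p q) d (inj₂ eq) with () ← trans (sym (flipLoc-other d p q)) eq

    module Edges {_≈_ : Node → Node → Set} {h : ℕ} (r : Realises _≈_ flip h) where

      open Realises r

      loopˣ : ∀ {d} → d < l → d ∉ C → (x , h + d) ≈ (x , h + (d + φ x))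
      loopˣ {d} d<l d∉C = loop-edge x d d<l
        (λ y eq → d∉C (proj₁ (status-top⁻¹ C (φ x) w (trans (sym (flipLoc-x d)) eq))))

      loopʷ : ∀ {d} → d < l → d ∉ D → (w , h + d) ≈ (w , h + (d + φ w))
      loopʷ {d} d<l d∉D = loop-edge w d d<l
        (λ y eq → d∉D (proj₁ (status-top⁻¹ D (φ w) x (trans (sym (flipLoc-w d)) eq))))

      loopᵒ : ∀ {z d} → z ≢ x → z ≢ w → d < l → (z , h + d) ≈ (z , h + (d + φ z))
      loopᵒ {z} {d} z≢x z≢w d<l = loop-edge z d d<l noTop
        where
        noTop : ∀ y → flipLoc z d ≢ top y
        noTop y eq with () ← trans (sym (flipLoc-other d z≢x z≢w)) eq

      end<l : ∀ {d} → End C (φ x) d → d < l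
      end<l (inj₁ p)              = ≤-trans (s≤s (m≤m+n _ _)) (boundˣ p)
      end<l (inj₂ (c , p , refl)) = boundˣ p

      rungs : ∀ {d} → End C (φ x) d → (x , h + d) ≈ (w , h + d)
      rungs {d} e = rung-edge x d (end<l e)
        (subst (λ s → Rung s w) (sym (flipLoc-x d)) (status-rung C (φ x) w disjˣ e))

-- Action of flips on strands and construction of joiners

module Joiners {n : ℕ} (κ : Fin n → ℕ) (G : Fin n → Fin n → Set)
  (G-sym : ∀ {x y} → G x y → G y x) (G-irrefl : ∀ {x} → ¬ G x x) where

  open Strands κ
  open Boxes κ G G-sym G-irrefl
  open Flips κ G G-sym G-irrefl
  open Transposition _≟ˢ_

  strand-0 : ∀ z d → d % φ z ≡ 0 → strand z d ≡ origin z
  strand-0 z d eq = strand-≡ z d 0 eq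

  strand-≢0 : ∀ z d → strand z d ≢ origin z → d % φ z ≢ 0
  strand-≢0 z d σ≢ eq = σ≢ (strand-0 z d eq)

  index-≢0 : ∀ {z i} → (z , i) ≢ origin z → toℕ i ≢ 0
  index-≢0 {z} {i} σ≢ eq = σ≢ (cong (z ,_) (Finₚ.toℕ-injective eq))

  straight-∣ : ∀ {l} → Λ ∣ l → ∀ σ → straight l σ ≡ σ
  straight-∣ {l} Λ∣l (z , i) = trans
    (strand-≡ z (l + toℕ i) (toℕ i) (%-remove-+ˡ (toℕ i) (∣-trans (φ∣Λ z) Λ∣l))) (strand-toℕ z i)

  at-top : ∀ h l z i → at (h + l) (z , i) ≡ (z , h + (l + toℕ i))
  at-top h l z i = cong (z ,_) (+-assoc h l (toℕ i))

  -- The strands at `h + l` are labelled less than `φ z` above it, so a loop edge ending at or below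
  -- such a node starts below `h + l`.
  below-top : ∀ {z l} (i : Fin (φ z)) {c} → c + φ z ≤ l + toℕ i → c < l
  below-top {z} {l} i {c} le = +-cancelʳ-< (φ z) c l (≤-trans (s≤s le) (+-monoʳ-< l (Finₚ.toℕ<n i)))

  module _ {_≈_ : Node → Node → Set} (isEq : IsEquivalence _≈_) where

    open IsEquivalence isEq renaming (refl to ≈-refl; sym to ≈-sym; trans to ≈-trans; reflexive to ≈-reflexive)

    descend : ∀ h z d →
      (∀ c → c + φ z ≤ d → c % φ z ≡ d % φ z → (z , h + c) ≈ (z , h + (c + φ z))) →
      (z , h + d) ≈ at h (strand z d)
    descend h z d step = ≈-sym (≈-trans (≈-reflexive (at-strand h z d))
      (climb isEq h z (m%n≤m d (φ z)) (m%n%n≡m%n d (φ z))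
        (λ c _ le eq → step c le (trans eq (m%n%n≡m%n d (φ z))))))

    pass-straight : ∀ h l z i →
      (∀ c → c < l → c % φ z ≡ (l + toℕ i) % φ z → (z , h + c) ≈ (z , h + (c + φ z))) →
      at (h + l) (z , i) ≈ at h (straight l (z , i))
    pass-straight h l z i step = ≈-trans (≈-reflexive (at-top h l z i))
      (descend h z (l + toℕ i) (λ c le eq → step c (below-top {z} i le) eq))

    -- Go down from `b` by loop edges until the height is less than `φ z` above `h`, or until a
    -- removed edge, whose upper end the hypothesis connects to one of the two boundaries.
    cover-fibre : ∀ h l z →
      (∀ c → c + φ z < l → (z , h + c) ≈ (z , h + (c + φ z)) ⊎
        (∃ λ σ → (z , h + (c + φ z)) ≈ at h σ ⊎ (z , h + (c + φ z)) ≈ at (h + l) σ)) →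
      ∀ b → h ≤ b → b < h + l → ∃ λ σ → (z , b) ≈ at h σ ⊎ (z , b) ≈ at (h + l) σ
    cover-fibre h l z stop b h≤b b<h+l =
      subst (λ m → ∃ λ σ → (z , m) ≈ at h σ ⊎ (z , m) ≈ at (h + l) σ) (m+[n∸m]≡n h≤b)
        (go (b ∸ h) (b ∸ h) ≤-refl (+-cancelˡ-< h (b ∸ h) l (subst (_< h + l) (sym (m+[n∸m]≡n h≤b)) b<h+l)))
      where
      go : ∀ fuel d → d ≤ fuel → d < l → ∃ λ σ → (z , h + d) ≈ at h σ ⊎ (z , h + d) ≈ at (h + l) σ
      go fuel d d≤fuel d<l with d <? φ z
      ... | yes d<φ = strand z d , inj₁ (≈-reflexive (sym (trans (at-strand h z d)
                        (cong (λ m → z , h + m) (m<n⇒m%n≡m d<φ)))))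
      go zero d d≤0 d<l | no d≮φ = ⊥-elim (d≮φ (≤-trans (s≤s d≤0) (s≤s z≤n)))
      go (suc fuel) d d≤fuel d<l | no d≮φ
        with d ∸ φ z | m∸n+n≡m (≮⇒≥ d≮φ)
      ... | c | refl with stop c d<l
      ...   | inj₂ p = p
      ...   | inj₁ edge with go fuel c (s≤s⁻¹ (≤-trans (m<m+n c (s≤s z≤n)) d≤fuel)) (≤-trans (s≤s (m≤m+n c (φ z))) d<l)
      ...     | σ , inj₁ p = σ , inj₁ (≈-trans (≈-sym edge) p)
      ...     | σ , inj₂ p = σ , inj₂ (≈-trans (≈-sym edge) p)

  module EqualLoops {x w : Fin n} (Gxw : G x w) (eq : φ x ≡ φ w) where

    l : ℕ
    -- A single `Λ` may equal `φ z`, whereas the edge removed above 0 has to end strictly inside the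
    -- box.
    l = Λ + Λ

    Λ∣l : Λ ∣ l
    Λ∣l = ∣m∣n⇒∣m+n ∣-refl ∣-refl

    φ<l : ∀ z → φ z < l
    φ<l z = ≤-trans (s≤s (φ≤Λ z)) (m<n+m Λ (n≢0⇒n>0 (≢-nonZero⁻¹ Λ)))

    bound : ∀ z {c} → c ∈ 0 ∷ [] → c + φ z < l
    bound z (here refl) = φ<l z

    disj : ∀ z → Disjoint (0 ∷ []) (φ z)
    disj z (here refl) (here refl) ()

    open Flip Gxw (0 ∷ []) (0 ∷ []) l (disj x) (disj w)
      (λ {d} → subst (λ r → End (0 ∷ []) r d) eq) (λ {d} → subst (λ r → End (0 ∷ []) r d) (sym eq))
      (bound x) (bound w)

    -- The strands through the origins are cut between 0 and the common loop value; the rung at 0 is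
    -- the cap, the other one, followed upwards, the cup. All other strands miss the cut and keep
    -- their labels, as `Λ` divides `l`.
    acts : Acts flip x w id
    acts {_≈_} isEq h real = record
      { cap = rungs (inj₁ (here refl)) ; cup = cup ; through = through ; cover = cover }
      where
      open IsEquivalence isEq renaming (refl to ≈-refl; sym to ≈-sym; trans to ≈-trans; reflexive to ≈-reflexive)
      open Edges real

      rise : ∀ z → (∀ {d} → d < l → d ∉ 0 ∷ [] → (z , h + d) ≈ (z , h + (d + φ z))) →
             (z , h + φ z) ≈ at (h + l) (origin z)
      rise z loop = ≈-trans
        (climb isEq h z (<⇒≤ (φ<l z))
          (trans (n%n≡0 (φ z)) (sym (n∣m⇒m%n≡0 l (φ z) (∣-trans (φ∣Λ z) Λ∣l))))
          (λ c φ≤c le _ → loop (≤-trans (m<m+n c (s≤s z≤n)) le) λ { (here refl) → n≮0 φ≤c }))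
        (≈-reflexive (trans (cong (λ m → z , h + m) (sym (+-identityʳ l))) (sym (at-top h l z zero))))

      rungˣ : (x , h + φ x) ≈ (w , h + φ x)
      rungˣ = rungs (inj₂ (0 , here refl , refl))

      cup : at (h + l) (origin x) ≈ at (h + l) (origin w)
      cup = ≈-trans (≈-sym (rise x loopˣ))
        (≈-trans rungˣ (≈-trans (≈-reflexive (cong (λ r → w , h + r) eq)) (rise w loopʷ)))

      through-fibre : ∀ z i → (z , i) ≢ origin z →
        (∀ {d} → d < l → d ∉ 0 ∷ [] → (z , h + d) ≈ (z , h + (d + φ z))) → at (h + l) (z , i) ≈ at h (z , i)
      through-fibre z i i≢0 loop = ≈-trans
        (pass-straight isEq h l z i (λ c c<l c≡ → loop c<l λ { (here refl) →
          strand-≢0 z (l + toℕ i) (λ e → i≢0 (trans (sym (straight-∣ Λ∣l (z , i))) e)) (sym c≡) }))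
        (≈-reflexive (cong (at h) (straight-∣ Λ∣l (z , i))))

      through : ∀ σ → σ ≢ origin x → σ ≢ origin w → at (h + l) σ ≈ at h σ
      through (z , i) p q with which z
      ... | is-x        = through-fibre x i p loopˣ
      ... | is-w        = through-fibre w i q loopʷ
      ... | other z≢x z≢w = ≈-trans (pass-straight isEq h l z i (λ c c<l _ → loopᵒ z≢x z≢w c<l))
                              (≈-reflexive (cong (at h) (straight-∣ Λ∣l (z , i))))

      cover-cut : ∀ z → (∀ {d} → d < l → d ∉ 0 ∷ [] → (z , h + d) ≈ (z , h + (d + φ z))) →
        ∀ b → h ≤ b → b < h + l → ∃ λ σ → (z , b) ≈ at h σ ⊎ (z , b) ≈ at (h + l) σ
      cover-cut z loop = cover-fibre isEq h l z λ
        { zero    _  → inj₂ (origin z , inj₂ (rise z loop))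
        ; (suc c) lt → inj₁ (loop (≤-trans (s≤s (m≤m+n (suc c) (φ z))) lt) λ { (here ()) }) }

      cover : ∀ z b → h ≤ b → b < h + l → ∃ λ σ → (z , b) ≈ at h σ ⊎ (z , b) ≈ at (h + l) σ
      cover z with which z
      ... | is-x = cover-cut x loopˣ
      ... | is-w = cover-cut w loopʷ
      ... | other z≢x z≢w = cover-fibre isEq h l z
              (λ c lt → inj₁ (loopᵒ z≢x z≢w (≤-trans (s≤s (m≤m+n c (φ z))) lt)))

  equal-joiner : ∀ {x w} → G x w → φ x ≡ φ w → Joiner x w
  equal-joiner Gxw eq = record { acts = EqualLoops.acts Gxw eq ; Λ∣len = EqualLoops.Λ∣l Gxw eq }

  -- The label reached at the bottom from `(a , φ a)`, the upper end of the edge removed above 0: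
  -- over the rung to `b` and down its fibre. If `φ b` divides `φ a`, this descent meets the edge
  -- removed at `b` above 0, and the rung at `φ b` leads back to `a`.
  turn : ∀ a b → Dec (φ b ∣ φ a) → Strand
  turn a b (yes _) = strand a (φ b)
  turn a b (no _)  = strand b (φ a)

  module Twist (x w : Fin n) (x≢w : x ≢ w)
    (s∣?r : Dec (φ w ∣ φ x)) (r∣?s : Dec (φ x ∣ φ w)) where

    X₀ X₁ W₀ W₁ : Strand
    X₀ = origin x
    X₁ = strand x (φ w)
    W₀ = origin w
    W₁ = strand w (φ x)

    fibres-≢ : ∀ {σ τ : Strand} → proj₁ σ ≡ x → proj₁ τ ≡ w → σ ≢ τ
    fibres-≢ refl refl eq = x≢w (cong proj₁ eq)

    -- A strand deflected by the cut changes fibre only if neither loop value divides the other.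
    cross : Dec (φ w ∣ φ x) → Dec (φ x ∣ φ w) → Strand → Strand
    cross (no _) (no _) = swap X₁ W₁
    cross _      _      = id

    cross-injective : ∀ p q → InjectiveFn (cross p q)
    cross-injective (no _)  (no _)  = swap-injective X₁ W₁
    cross-injective (no _)  (yes _) eq = eq
    cross-injective (yes _) _       eq = eq

    -- The correction of `straight l` caused by the cuts. `X₁` and `W₁`, to which `straight l` sends
    -- the origins, go to `X₀` and `W₀`: the result is a permutation fixing both origins. Any other
    -- strand heading for an origin is sent to `turn`.
    twist : Strand → Strand
    twist = cross s∣?r r∣?s ∘ swap X₀ X₁ ∘ swap W₀ W₁

    twist-injective : InjectiveFn twist
    twist-injective = swap-injective W₀ W₁ ∘ swap-injective X₀ X₁ ∘ cross-injective s∣?r r∣?s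

    X₁≡X₀⇒∣ : X₁ ≡ X₀ → φ x ∣ φ w
    X₁≡X₀⇒∣ eq = m%n≡0⇒n∣m (φ w) (φ x) (strand-injective x (φ w) 0 eq)

    W₁≡W₀⇒∣ : W₁ ≡ W₀ → φ w ∣ φ x
    W₁≡W₀⇒∣ eq = m%n≡0⇒n∣m (φ x) (φ w) (strand-injective w (φ x) 0 eq)

    cross-fixes : ∀ p q {σ} → σ ≢ X₁ → σ ≢ W₁ → cross p q σ ≡ σ
    cross-fixes (no _)  (no _)  σ≢X₁ σ≢W₁ = swap-other σ≢X₁ σ≢W₁
    cross-fixes (no _)  (yes _) _ _ = refl
    cross-fixes (yes _) _       _ _ = refl

    cross-X₀ : ∀ p q → cross p q X₀ ≡ X₀
    cross-X₀ (no _)  (no r∤s) = swap-other (r∤s ∘ X₁≡X₀⇒∣ ∘ sym) (fibres-≢ refl refl)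
    cross-X₀ (no _)  (yes _)  = refl
    cross-X₀ (yes _) _        = refl

    cross-W₀ : ∀ p q → cross p q W₀ ≡ W₀
    cross-W₀ (no s∤r) (no _)  = swap-other (fibres-≢ refl refl ∘ sym) (s∤r ∘ W₁≡W₀⇒∣ ∘ sym)
    cross-W₀ (no _)   (yes _) = refl
    cross-W₀ (yes _)  _       = refl

    cross-X₁ : ∀ p q → ¬ (φ x ∣ φ w) → cross p q X₁ ≡ turn x w p
    cross-X₁ (no _)  (no _)    _   = swap-left X₁ W₁
    cross-X₁ (no _)  (yes r∣s) r∤s = ⊥-elim (r∤s r∣s)
    cross-X₁ (yes _) _         _   = refl

    cross-W₁ : ∀ p q → ¬ (φ w ∣ φ x) → cross p q W₁ ≡ turn w x q
    cross-W₁ (no _)    (no _)  _   = swap-right X₁ W₁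
    cross-W₁ (no _)    (yes _) _   = refl
    cross-W₁ (yes s∣r) _       s∤r = ⊥-elim (s∤r s∣r)

    twist-X₁ : twist X₁ ≡ X₀
    twist-X₁ = trans (cong (cross s∣?r r∣?s) (trans (cong (swap X₀ X₁) (swap-other (fibres-≢ refl refl) (fibres-≢ refl refl))) (swap-right X₀ X₁)))
      (cross-X₀ s∣?r r∣?s)

    twist-W₁ : twist W₁ ≡ W₀
    twist-W₁ = trans (cong (cross s∣?r r∣?s) (trans (cong (swap X₀ X₁) (swap-right W₀ W₁)) (swap-other (fibres-≢ refl refl ∘ sym) (fibres-≢ refl refl ∘ sym))))
      (cross-W₀ s∣?r r∣?s)

    twist-X₀ : ¬ (φ x ∣ φ w) → twist X₀ ≡ turn x w s∣?r
    twist-X₀ r∤s = trans (cong (cross s∣?r r∣?s) (trans (cong (swap X₀ X₁) (swap-other (fibres-≢ refl refl) (fibres-≢ refl refl))) (swap-left X₀ X₁)))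
      (cross-X₁ s∣?r r∣?s r∤s)

    twist-W₀ : ¬ (φ w ∣ φ x) → twist W₀ ≡ turn w x r∣?s
    twist-W₀ s∤r = trans (cong (cross s∣?r r∣?s) (trans (cong (swap X₀ X₁) (swap-left W₀ W₁)) (swap-other (fibres-≢ refl refl ∘ sym) (fibres-≢ refl refl ∘ sym))))
      (cross-W₁ s∣?r r∣?s s∤r)

    twist-fixes : ∀ {σ} → σ ≢ X₀ → σ ≢ X₁ → σ ≢ W₀ → σ ≢ W₁ → twist σ ≡ σ
    twist-fixes {σ} p q p′ q′ = trans
      (cong (cross s∣?r r∣?s) (trans (cong (swap X₀ X₁) (swap-other p′ q′)) (swap-other p q)))
      (cross-fixes s∣?r r∣?s q q′)

  -- One side of a flip removing the loop edges above 0 and φ w from the fibre of x and those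
  -- above 0 and φ x from the fibre of w.
  module FlipSide {_≈_ : Node → Node → Set} (isEq : IsEquivalence _≈_) {x w : Fin n} (h l : ℕ)
    (l≡ : l ≡ Λ + (φ x + φ w)) (φ≢ : φ x ≢ φ w) (s∣?r : Dec (φ w ∣ φ x))
    (loopˣ : ∀ {d} → d < l → d ≢ 0 → d ≢ φ w → (x , h + d) ≈ (x , h + (d + φ x)))
    (loopʷ : ∀ {d} → d < l → d ≢ 0 → d ≢ φ x → (w , h + d) ≈ (w , h + (d + φ w)))
    (rungʳ : (x , h + φ x) ≈ (w , h + φ x)) (rungˢ : (x , h + φ w) ≈ (w , h + φ w))
    where

    open IsEquivalence isEq renaming (refl to ≈-refl; sym to ≈-sym; trans to ≈-trans; reflexive to ≈-reflexive)

    r s : ℕ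
    r = φ x
    s = φ w

    r+s≤l : r + s ≤ l
    r+s≤l = subst (r + s ≤_) (sym l≡) (m≤n+m (r + s) Λ)

    l+-% : ∀ i → (l + i) % r ≡ (s + i) % r
    l+-% i = begin
      (l + i) % r             ≡⟨ cong (λ m → (m + i) % r) l≡ ⟩
      (Λ + (r + s) + i) % r   ≡⟨ cong (_% r) (trans (+-assoc Λ (r + s) i) (cong (Λ +_) (+-assoc r s i))) ⟩
      (Λ + (r + (s + i))) % r ≡⟨ %-remove-+ˡ (r + (s + i)) (φ∣Λ x) ⟩
      (r + (s + i)) % r       ≡⟨ %-remove-+ˡ (s + i) (∣-refl {r}) ⟩
      (s + i) % r             ∎
      where open ≡-Reasoning

    -- Both edges removed at `x` start below `s + r`, and `l` agrees with `s + r` modulo `r`.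
    rise : (x , h + (s + r)) ≈ at (h + l) (origin x)
    rise = ≈-trans
      (climb isEq h x s+r≤l0 eq (λ c le le′ _ → loopˣ (≤-trans (m<m+n c (s≤s z≤n)) (subst (c + r ≤_) (+-identityʳ l) le′))
        (λ { refl → n≮0 le }) (λ { refl → <⇒≱ (m<m+n s (s≤s z≤n)) le })))
      (≈-reflexive (sym (at-top h l x zero)))
      where
      s+r≤l0 : s + r ≤ l + 0
      s+r≤l0 = subst₂ _≤_ (+-comm r s) (sym (+-identityʳ l)) r+s≤l
      eq : (s + r) % r ≡ (l + 0) % r
      eq = begin
        (s + r) % r ≡⟨ %-remove-+ʳ s (∣-refl {r}) ⟩
        s % r       ≡⟨ cong (_% r) (+-identityʳ s) ⟨
        (s + 0) % r ≡⟨ l+-% 0 ⟨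
        (l + 0) % r ∎
        where open ≡-Reasoning

    turns : ∀ p → (x , h + r) ≈ at h (turn x w p)
    turns (no s∤r) = ≈-trans rungʳ (descend isEq h w r (λ c le eq →
            loopʷ (≤-trans (m<m+n c (s≤s z≤n)) (≤-trans le (≤-trans (m≤m+n r s) r+s≤l)))
              (λ { refl → s∤r (m%n≡0⇒n∣m r s (sym eq)) })
              (λ { refl → <⇒≱ (m<m+n r (s≤s z≤n)) le })))
    -- The way down at `w` stops at `s`, the upper end of the edge removed above 0. Over the rung at
    -- `s` it goes on down at `x`; meeting 0 there would need `r ∣ s`, hence equal loop values.
    turns (yes s∣r) = ≈-trans rungʳ (≈-trans (≈-sym
            (climb isEq h w (∣⇒≤ s∣r) (trans (n%n≡0 s) (sym (n∣m⇒m%n≡0 r s s∣r))) (λ c s≤c le _ →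
              loopʷ (≤-trans (m<m+n c (s≤s z≤n)) (≤-trans le (≤-trans (m≤m+n r s) r+s≤l)))
                (λ { refl → n≮0 s≤c })
                (λ { refl → <⇒≱ (m<m+n r (s≤s z≤n)) le }))))
            (≈-trans (≈-sym rungˢ) (descend isEq h x s (λ c le eq →
              loopˣ (≤-trans (m<m+n c (s≤s z≤n)) (≤-trans le (≤-trans (m≤n+m s r) r+s≤l)))
                (λ { refl → φ≢ (∣-antisym (m%n≡0⇒n∣m s r (sym eq)) s∣r) })
                (λ { refl → <⇒≱ (m<m+n s (s≤s z≤n)) le })))))

    turnˣ : (x , h + r) ≈ at h (turn x w s∣?r)
    turnˣ = turns s∣?r

    module _ (i : Fin r) (i≢0 : (x , i) ≢ origin x) where

      -- The strand with label `i` at the top runs in the class of `s + i` modulo `r`, which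
      -- contains `s` only for label 0.
      avoids-s : ∀ {c} → c % r ≡ (l + toℕ i) % r → c ≢ s
      avoids-s eq refl = index-≢0 i≢0 (begin
        toℕ i     ≡⟨ m<n⇒m%n≡m (Finₚ.toℕ<n i) ⟨
        toℕ i % r ≡⟨ +-cancel-% r s (toℕ i) 0 (begin
          (s + toℕ i) % r ≡⟨ l+-% (toℕ i) ⟨
          (l + toℕ i) % r ≡⟨ eq ⟨
          s % r           ≡⟨ cong (_% r) (+-identityʳ s) ⟨
          (s + 0) % r     ∎) ⟩
        0         ∎)
        where open ≡-Reasoning

      pass-regular : straight l (x , i) ≢ origin x → at (h + l) (x , i) ≈ at h (straight l (x , i))
      pass-regular σ≢ = pass-straight isEq h l x i (λ c c<l eq →
        loopˣ c<l (λ { refl → strand-≢0 x (l + toℕ i) σ≢ (sym eq) }) (avoids-s eq))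

      pass-turn : straight l (x , i) ≡ origin x → at (h + l) (x , i) ≈ at h (turn x w s∣?r)
      pass-turn σ≡ = ≈-trans (≈-reflexive (at-top h l x i)) (≈-trans (≈-sym
        (climb isEq h x (≤-trans (m≤m+n r s) (≤-trans r+s≤l (m≤m+n l (toℕ i)))) (trans (n%n≡0 r) (sym eq₀))
          (λ c r≤c le eq → loopˣ (below-top {x} i le) (λ { refl → n≮0 r≤c })
            (avoids-s (trans eq (trans (n%n≡0 r) (sym eq₀))))))) turnˣ)
        where
        eq₀ : (l + toℕ i) % r ≡ 0
        eq₀ = strand-injective x (l + toℕ i) 0 σ≡

    cover-side : ∀ b → h ≤ b → b < h + l → ∃ λ σ → (x , b) ≈ at h σ ⊎ (x , b) ≈ at (h + l) σ
    cover-side = cover-fibre isEq h l x stop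
      where
      stop : ∀ c → c + r < l → (x , h + c) ≈ (x , h + (c + r)) ⊎
             (∃ λ σ → (x , h + (c + r)) ≈ at h σ ⊎ (x , h + (c + r)) ≈ at (h + l) σ)
      stop c lt with c ≟ 0 | c ≟ s
      ... | yes refl | _        = inj₂ (turn x w s∣?r , inj₁ turnˣ)
      ... | no _     | yes refl = inj₂ (origin x , inj₂ rise)
      ... | no c≢0   | no c≢s   = inj₁ (loopˣ (≤-trans (s≤s (m≤m+n c r)) lt) c≢0 c≢s)

  module UnequalLoops {x w : Fin n} (Gxw : G x w) (φ≢ : φ x ≢ φ w) where

    r s l : ℕ
    r = φ x
    s = φ w
    -- The last removed edges end at `r + s`. The summand `Λ` makes room above them and keeps the
    -- residues: `s` modulo `r`, and `r` modulo `s`.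
    l = Λ + (r + s)

    disj : ∀ {a b} → suc a ≢ b → Disjoint (0 ∷ b ∷ []) (suc a)
    disj {a} {b} a≢b (here refl) (here refl) ()
    disj {a} {b} a≢b (here refl) (there (here refl)) eq = m+1+n≢0 b (sym eq)
    disj {a} {b} a≢b (there (here refl)) (here refl) eq = a≢b (sym eq)
    disj {a} {b} a≢b (there (here refl)) (there (here refl)) eq = m+1+n≢m b (sym eq)

    ends : ∀ {a b d} → End (0 ∷ b ∷ []) a d → End (0 ∷ a ∷ []) b d
    ends (inj₁ (here refl))                 = inj₁ (here refl)
    ends (inj₁ (there (here refl)))         = inj₂ (0 , here refl , refl)
    ends (inj₂ (_ , here refl , refl))      = inj₁ (there (here refl))
    ends {a} {b} (inj₂ (_ , there (here refl) , refl)) = inj₂ (a , there (here refl) , +-comm b a)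

    bound : ∀ {a b} → a + b ≡ r + s → ∀ {c} → c ∈ 0 ∷ b ∷ [] → c + a < l
    bound {a} {b} eq p = ≤-trans (s≤s (≤-trans (below p) (≤-reflexive eq))) (m<n+m (r + s) (n≢0⇒n>0 (≢-nonZero⁻¹ Λ)))
      where
      below : ∀ {c} → c ∈ 0 ∷ b ∷ [] → c + a ≤ a + b
      below (here refl)         = m≤m+n a b
      below (there (here refl)) = ≤-reflexive (+-comm b a)

    open Flip Gxw (0 ∷ s ∷ []) (0 ∷ r ∷ []) l (disj φ≢) (disj (φ≢ ∘ sym)) ends ends
      (bound refl) (bound (+-comm s r)) public

    open Twist x w x≢w (s ∣? r) (r ∣? s)

    permutation : Strand → Strand
    permutation = twist ∘ straight l

    permutation-injective : InjectiveFn permutation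
    permutation-injective = straight-injective l ∘ twist-injective

    straight-X₀ : straight l X₀ ≡ X₁
    straight-X₀ = strand-≡ x (l + 0) s (begin
      (l + 0) % r       ≡⟨ cong (_% r) (+-identityʳ l) ⟩
      (Λ + (r + s)) % r ≡⟨ %-remove-+ˡ (r + s) (φ∣Λ x) ⟩
      (r + s) % r       ≡⟨ %-remove-+ˡ s (∣-refl {r}) ⟩
      s % r             ∎)
      where open ≡-Reasoning

    straight-W₀ : straight l W₀ ≡ W₁
    straight-W₀ = strand-≡ w (l + 0) r (begin
      (l + 0) % s       ≡⟨ cong (_% s) (+-identityʳ l) ⟩
      (Λ + (r + s)) % s ≡⟨ %-remove-+ˡ (r + s) (φ∣Λ w) ⟩
      (r + s) % s       ≡⟨ %-remove-+ʳ r (∣-refl {s}) ⟩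
      r % s             ∎)
      where open ≡-Reasoning

    permutation-X₀ : permutation X₀ ≡ X₀
    permutation-X₀ = trans (cong twist straight-X₀) twist-X₁

    permutation-W₀ : permutation W₀ ≡ W₀
    permutation-W₀ = trans (cong twist straight-W₀) twist-W₁

    acts : Acts flip x w permutation
    acts {_≈_} isEq h real = record
      { cap = rungs (inj₁ (here refl)) ; cup = cup ; through = through ; cover = cover }
      where
      open IsEquivalence isEq renaming (refl to ≈-refl; sym to ≈-sym; trans to ≈-trans; reflexive to ≈-reflexive)
      open Edges real

      rungʳ : (x , h + r) ≈ (w , h + r)
      rungʳ = rungs (inj₂ (0 , here refl , refl))

      rungˢ : (x , h + s) ≈ (w , h + s)
      rungˢ = rungs (inj₁ (there (here refl)))

      avoid : ∀ {a d} → d ≢ 0 → d ≢ a → d ∉ 0 ∷ a ∷ []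
      avoid d≢0 d≢a (here eq)         = d≢0 eq
      avoid d≢0 d≢a (there (here eq)) = d≢a eq

      module X = FlipSide isEq {x} {w} h l refl φ≢ (s ∣? r)
        (λ d<l p q → loopˣ d<l (avoid p q)) (λ d<l p q → loopʷ d<l (avoid p q)) rungʳ rungˢ
      module W = FlipSide isEq {w} {x} h l (cong (Λ +_) (+-comm r s)) (φ≢ ∘ sym) (r ∣? s)
        (λ d<l p q → loopʷ d<l (avoid p q)) (λ d<l p q → loopˣ d<l (avoid p q)) (≈-sym rungˢ) (≈-sym rungʳ)

      cup : at (h + l) X₀ ≈ at (h + l) W₀
      cup = ≈-trans (≈-sym X.rise) (≈-trans (rungs (inj₂ (s , there (here refl) , refl)))
        (≈-trans (≈-reflexive (cong (λ m → w , h + m) (+-comm s r))) W.rise))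

      throughˣ : ∀ i → (x , i) ≢ X₀ → Dec (straight l (x , i) ≡ X₀) → at (h + l) (x , i) ≈ at h (permutation (x , i))
      throughˣ i p (no σ≢) = ≈-trans (X.pass-regular i p σ≢) (≈-reflexive (cong (at h) (sym
        (twist-fixes σ≢ (λ eq → p (straight-injective l (trans eq (sym straight-X₀))))
          (fibres-≢ refl refl) (fibres-≢ refl refl)))))
      throughˣ i p (yes σ≡) = ≈-trans (X.pass-turn i p σ≡)
        (≈-reflexive (cong (at h) (sym (trans (cong twist σ≡) (twist-X₀ r∤s)))))
        where
        -- If `r ∣ s`, the strand running straight into the origin is the one with label 0, which is
        -- excluded.
        r∤s : ¬ (r ∣ s)
        r∤s r∣s = p (straight-injective l (trans σ≡ (trans (sym (strand-0 x s (n∣m⇒m%n≡0 s r r∣s))) (sym straight-X₀))))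

      throughʷ : ∀ i → (w , i) ≢ W₀ → Dec (straight l (w , i) ≡ W₀) → at (h + l) (w , i) ≈ at h (permutation (w , i))
      throughʷ i p (no σ≢) = ≈-trans (W.pass-regular i p σ≢) (≈-reflexive (cong (at h) (sym
        (twist-fixes (fibres-≢ refl refl ∘ sym) (fibres-≢ refl refl ∘ sym) σ≢
          (λ eq → p (straight-injective l (trans eq (sym straight-W₀))))))))
      throughʷ i p (yes σ≡) = ≈-trans (W.pass-turn i p σ≡)
        (≈-reflexive (cong (at h) (sym (trans (cong twist σ≡) (twist-W₀ s∤r)))))
        where
        s∤r : ¬ (s ∣ r)
        s∤r s∣r = p (straight-injective l (trans σ≡ (trans (sym (strand-0 w r (n∣m⇒m%n≡0 r s s∣r))) (sym straight-W₀))))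

      through-in : ∀ {z} → Which z → ∀ i → (z , i) ≢ X₀ → (z , i) ≢ W₀ → at (h + l) (z , i) ≈ at h (permutation (z , i))
      through-in is-x i p q = throughˣ i p (straight l (x , i) ≟ˢ X₀)
      through-in is-w i p q = throughʷ i q (straight l (w , i) ≟ˢ W₀)
      through-in {z} (other z≢x z≢w) i p q = ≈-trans (pass-straight isEq h l z i (λ c c<l _ → loopᵒ z≢x z≢w c<l))
        (≈-reflexive (cong (at h) (sym (twist-fixes (z≢x ∘ cong proj₁) (z≢x ∘ cong proj₁) (z≢w ∘ cong proj₁) (z≢w ∘ cong proj₁)))))

      through : ∀ σ → σ ≢ X₀ → σ ≢ W₀ → at (h + l) σ ≈ at h (permutation σ)
      through (z , i) = through-in (which z) i

      cover : ∀ z b → h ≤ b → b < h + l → ∃ λ σ → (z , b) ≈ at h σ ⊎ (z , b) ≈ at (h + l) σ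
      cover z with which z
      ... | is-x = X.cover-side
      ... | is-w = W.cover-side
      ... | other z≢x z≢w = cover-fibre isEq h l z
              (λ c lt → inj₁ (loopᵒ z≢x z≢w (≤-trans (s≤s (m≤m+n c (φ z))) lt)))

  joiner : ∀ {x w z} → G x w → z ≢ w → z ≢ x → Joiner z x → Joiner x w
  joiner {x} {w} {z} Gxw z≢w z≢x sep with φ x ≟ φ w
  ... | yes eq = equal-joiner Gxw eq
  ... | no φ≢  = record
    { box   = alternate flip (Joiner.box sep) m
    ; acts  = λ isEq h real → tangle-cong isEq (λ σ → trans (cong (λ k → iter permutation k σ) (suc-pred order)) (identity σ))
                (alternate-acts z≢x z≢w x≢w permutation-injective permutation-X₀ permutation-W₀ acts (Joiner.acts sep) m isEq h real)
    ; Λ∣len = alternate-∣ flip (Joiner.box sep) m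
                (subst (λ k → Λ ∣ k * l) (sym (suc-pred order)) (∣m⇒∣m*n l (m∣m*n ((n * Λ) !)))) (Joiner.Λ∣len sep)
    }
    where
    open UnequalLoops Gxw φ≢
    -- The factorial is a period of every strand under the permutation, as there are at most `n * Λ`
    -- strands; the factor `Λ` makes the total length of the flips divisible by `Λ`.
    order = Λ * (n * Λ) !
    instance
      order-nonZero : NonZero order
      order-nonZero = m*n≢0 Λ ((n * Λ) !) {{it}} {{(n * Λ) !≢0}}
    -- `alternate` contains one flip more than its argument says.
    m = pred order
    identity : ∀ σ → iter permutation order σ ≡ σ
    identity σ = iter-* permutation Λ ((n * Λ) !) σ
      (iter-order permutation strandIndex strandIndex-injective permutation-injective σ)

-- Growth of a tree from its root edge, and multiples of a unit modulo d

data Growth {n : ℕ} (G : Fin n → Fin n → Set) (u v : Fin n) : List (Fin n) → Set where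
  root : Growth G u v (u ∷ v ∷ [])
  grow : ∀ {L x w} → Growth G u v L → x ∈ L → w ∉ L → G x w → Growth G u v (w ∷ L)

inverse-% : ∀ ρ d .{{_ : NonZero d}} → Coprime ρ d → ∃ λ a → (a * ρ) % d ≡ 1 % d
inverse-% ρ d@(suc k) coprime with coprime-Bézout coprime
... | Bézout.+- x y eq = x , trans (cong (_% d) (sym eq)) ([m+kn]%n≡m%n 1 y d)
-- Here `1 + x * ρ` is a multiple of `d`, so `x` inverts the negative of `ρ`; the factor `k`, which
-- is `d` - 1, corrects the sign.
... | Bézout.-+ x y eq = x * k , (begin
    (x * k * ρ) % d           ≡⟨ [m+kn]%n≡m%n (x * k * ρ) 1 d ⟨
    (x * k * ρ + 1 * d) % d   ≡⟨ cong (_% d) shuffle ⟩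
    (1 + k * y * d) % d       ≡⟨ [m+kn]%n≡m%n 1 (k * y) d ⟩
    1 % d                     ∎)
  where
  open ≡-Reasoning
  open ℕ-Solver
  shuffle : x * k * ρ + 1 * d ≡ 1 + k * y * d
  shuffle = begin
    x * k * ρ + 1 * (1 + k) ≡⟨ solve 3 (λ x k ρ → x :* k :* ρ :+ con 1 :* (con 1 :+ k) := con 1 :+ k :* (con 1 :+ x :* ρ)) refl x k ρ ⟩
    1 + k * (1 + x * ρ)     ≡⟨ cong (λ m → 1 + k * m) eq ⟩
    1 + k * (y * d)         ≡⟨ cong suc (*-assoc k y d) ⟨
    1 + k * y * d           ∎

multiples-% : ∀ ρ d .{{_ : NonZero d}} → Coprime ρ d → ∀ i → ∃ λ j → (suc j * ρ) % d ≡ i % d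
multiples-% ρ d coprime i with inverse-% ρ d coprime
-- An additional `d` makes the multiplier positive, since `around` describes at least one lap.
... | a , inv = pred d + i * a , (begin
    (suc (pred d + i * a) * ρ) % d        ≡⟨ cong (λ m → ((m + i * a) * ρ) % d) (suc-pred d) ⟩
    ((d + i * a) * ρ) % d                 ≡⟨ cong (_% d) (*-distribʳ-+ ρ d (i * a)) ⟩
    (d * ρ + i * a * ρ) % d               ≡⟨ %-remove-+ˡ (i * a * ρ) (m∣m*n ρ) ⟩
    (i * a * ρ) % d                       ≡⟨ cong (_% d) (*-assoc i a ρ) ⟩
    (i * (a * ρ)) % d                     ≡⟨ %-distribˡ-* i (a * ρ) d ⟩
    ((i % d) * ((a * ρ) % d)) % d         ≡⟨ cong (λ m → ((i % d) * m) % d) inv ⟩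
    ((i % d) * (1 % d)) % d               ≡⟨ %-distribˡ-* i 1 d ⟨
    (i * 1) % d                           ≡⟨ cong (_% d) (*-identityʳ i) ⟩
    i % d                                 ∎)
  where open ≡-Reasoning

-- The stack of the boxes of all tree edges, and its connectedness

module Assembly {n : ℕ} (κ : Fin n → ℕ) (G : Fin n → Fin n → Set)
  (G-sym : ∀ {x y} → G x y → G y x) (G-irrefl : ∀ {x} → ¬ G x x)
  (u v : Fin n) (Guv : G u v) (κu : κ u ≡ 0) (κv : κ v ≡ 0) where

  open Strands κ
  open Boxes κ G G-sym G-irrefl
  open Joiners κ G G-sym G-irrefl

  ∈∉⇒≢ : ∀ {L : List (Fin n)} {x w} → x ∈ L → w ∉ L → x ≢ w
  ∈∉⇒≢ x∈ w∉ refl = w∉ x∈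

  u≢v : u ≢ v
  u≢v refl = G-irrefl Guv

  rootJoiner : Joiner u v
  rootJoiner = equal-joiner Guv (cong suc (trans κu (sym κv)))

  -- This is where two adjacent loops with φ = 1 are needed: each of the two root fibres provides
  -- the separating tangles for the children of the other.
  mutual

    separator : ∀ {L} → Growth G u v L → ∀ {x} → x ∈ L → ∃ λ z → z ∈ L × z ≢ x × Joiner z x
    separator root (here refl)         = v , there (here refl) , u≢v ∘ sym , joiner-sym rootJoiner
    separator root (there (here refl)) = u , here refl , u≢v , rootJoiner
    -- The separator of a new leaf is the box that joins it to its parent.
    separator (grow {x = x} t x∈ w∉ g) (here refl) = x , there x∈ , ∈∉⇒≢ x∈ w∉ , leafJoiner t x∈ w∉ g
    separator (grow t _ _ _) (there y∈) =
      let z , z∈ , z≢y , j = separator t y∈ in z , there z∈ , z≢y , j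

    leafJoiner : ∀ {L} → Growth G u v L → ∀ {x w} → x ∈ L → w ∉ L → G x w → Joiner x w
    leafJoiner t x∈ w∉ g =
      let z , z∈ , z≢x , j = separator t x∈ in joiner g (∈∉⇒≢ z∈ w∉) z≢x j

  assembly : ∀ {L} → Growth G u v L → Box
  assembly root              = Joiner.box rootJoiner
  assembly (grow t x∈ w∉ g) = seq (assembly t) (Joiner.box (leafJoiner t x∈ w∉ g))

  size : ∀ {L} → Growth G u v L → ℕ
  size t = Box.len (assembly t)

  Λ∣size : ∀ {L} (t : Growth G u v L) → Λ ∣ size t
  Λ∣size root              = Joiner.Λ∣len rootJoiner
  Λ∣size (grow t x∈ w∉ g) = ∣m∣n⇒∣m+n (Λ∣size t) (Joiner.Λ∣len (leafJoiner t x∈ w∉ g))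

  straight-strand : ∀ ρ z d → straight ρ (strand z d) ≡ strand z (ρ + d)
  straight-strand ρ z d = strand-≡ z (ρ + toℕ (d mod φ z)) (ρ + d) (begin
    (ρ + toℕ (d mod φ z)) % φ z       ≡⟨ cong (λ m → (ρ + m) % φ z) (Finₚ.toℕ-fromℕ< (m%n<n d (φ z))) ⟩
    (ρ + d % φ z) % φ z               ≡⟨ %-distribˡ-+ ρ (d % φ z) (φ z) ⟩
    (ρ % φ z + d % φ z % φ z) % φ z   ≡⟨ cong (λ m → (ρ % φ z + m) % φ z) (m%n%n≡m%n d (φ z)) ⟩
    (ρ % φ z + d % φ z) % φ z         ≡⟨ %-distribˡ-+ ρ d (φ z) ⟨
    (ρ + d) % φ z                     ∎)
    where open ≡-Reasoning

  module _ (ρ : ℕ) (coprime : ∀ z → Coprime ρ (φ z)) where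

    reached : ∀ z i → ∃ λ j → strand z (suc j * ρ) ≡ (z , i)
    reached z i with multiples-% ρ (φ z) (coprime z) (toℕ i)
    ... | j , eq = j , trans (strand-≡ z (suc j * ρ) (toℕ i) eq) (strand-toℕ z i)

    straight-surjective : ∀ z i → ∃ λ k → straight ρ (z , k) ≡ (z , i)
    straight-surjective z i with reached z i
    ... | j , eq = proj₂ (strand z (j * ρ)) , trans (straight-strand ρ z (j * ρ)) eq

  module _ {_≈_ : Node → Node → Set} (isEq : IsEquivalence _≈_) (h : ℕ) where

    open IsEquivalence isEq renaming (refl to ≈-refl; sym to ≈-sym; trans to ≈-trans; reflexive to ≈-reflexive)

    module Leaf {L} (t : Growth G u v L) {x w} (x∈ : x ∈ L) (w∉ : w ∉ L) (g : G x w)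
      (real : Realises _≈_ (assembly (grow t x∈ w∉ g)) h) where

      leaf : Joiner x w
      leaf = leafJoiner t x∈ w∉ g

      h₁ h₂ : ℕ
      h₁ = h + size t
      h₂ = h + size (grow t x∈ w∉ g)

      lower : Realises _≈_ (assembly t) h
      lower = realises-low (assembly t) (Joiner.box leaf) real

      tangle : Tangle _≈_ x w id h₁ h₂
      tangle = subst (Tangle _≈_ x w id h₁) (+-assoc h (size t) _)
        (Joiner.acts leaf isEq h₁ (realises-high (assembly t) (Joiner.box leaf) real))

      open Tangle tangle public

    -- The boxes turn back only strands of fibres in `L`; every other strand passes each of them
    -- with its label.
    pass-outside : ∀ {L} (t : Growth G u v L) → Realises _≈_ (assembly t) h →
      ∀ {z} i → z ∉ L → at (h + size t) (z , i) ≈ at h (z , i)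
    pass-outside root real i z∉ = Tangle.through (Joiner.acts rootJoiner isEq h real) _
      (λ eq → z∉ (here (cong proj₁ eq))) (λ eq → z∉ (there (here (cong proj₁ eq))))
    pass-outside (grow t x∈ w∉ g) real i z∉ = ≈-trans
      (through _ (λ eq → z∉ (there (subst (_∈ _) (sym (cong proj₁ eq)) x∈))) (λ eq → z∉ (here (cong proj₁ eq))))
      (pass-outside t lower i (z∉ ∘ there))
      where open Leaf t x∈ w∉ g real

    cover-assembly : ∀ {L} (t : Growth G u v L) → Realises _≈_ (assembly t) h →
      ∀ z b → h ≤ b → b < h + size t → ∃ λ σ → (z , b) ≈ at h σ ⊎ (z , b) ≈ at (h + size t) σ
    cover-assembly root real = Tangle.cover (Joiner.acts rootJoiner isEq h real)
    cover-assembly {_} (grow {x = x} {w = w} t x∈ w∉ g) real z b h≤b b<h₂ = split (b <? h₁)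
      where
      open Leaf t x∈ w∉ g real
      -- Of the two strands that the leaf tangle turns back, that of `x` is joined by the cap to
      -- that of `w`, and the boxes below pass the latter on because `w ∉ L`.
      middle : ∀ σ → ∃ λ τ → at h₁ σ ≈ at h τ ⊎ at h₁ σ ≈ at h₂ τ
      middle σ with σ ≟ˢ origin x | σ ≟ˢ origin w
      ... | yes refl | _        = origin w , inj₁ (≈-trans cap (pass-outside t lower zero w∉))
      ... | no _     | yes refl = origin w , inj₁ (pass-outside t lower zero w∉)
      ... | no p     | no q     = σ , inj₂ (≈-sym (through σ p q))
      extend : ∀ {a} → (∃ λ σ → a ≈ at h₁ σ) → ∃ λ τ → a ≈ at h τ ⊎ a ≈ at h₂ τ
      extend (σ , p) with middle σ
      ... | τ , inj₁ q = τ , inj₁ (≈-trans p q)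
      ... | τ , inj₂ q = τ , inj₂ (≈-trans p q)
      split : Dec (b < h₁) → ∃ λ σ → (z , b) ≈ at h σ ⊎ (z , b) ≈ at h₂ σ
      split (yes b<h₁) with cover-assembly t lower z b h≤b b<h₁
      ... | σ , inj₁ p = σ , inj₁ p
      ... | σ , inj₂ p = extend (σ , p)
      split (no b≮h₁) with cover z b (≮⇒≥ b≮h₁) b<h₂
      ... | σ , inj₁ p = extend (σ , p)
      ... | σ , inj₂ p = σ , inj₂ p

    -- Closing the circle shifts the strands by ρ; as ρ is prime to φ w, following the strands
    -- of a leaf w from the upper end of its tangle leads through all of them to the lower end.
    module _ (ρ : ℕ) (coprime : ∀ z → Coprime ρ (φ z)) where

      Seam : List (Fin n) → ℕ → Set
      Seam L h′ = ∀ z i → z ∈ L → at h (z , i) ≈ at h′ (straight ρ (z , i))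

      root-connected : ∀ z i → κ z ≡ 0 → at h (z , i) ≡ at h (origin z)
      root-connected z zero    κz = refl
      root-connected z (suc i) κz with () ← subst Fin κz i

      -- Leaves are taken off one at a time. The fibre of the leaf joins the upper end of its tangle
      -- to the lower one, so the turning strand of `x` gets through as well; the top box then acts
      -- on `L` as the identity, and the seam carries over to the shorter stack.
      connected : ∀ {L} (t : Growth G u v L) → Realises _≈_ (assembly t) h → Seam L (h + size t) →
        ∀ z i → z ∈ L → at h (z , i) ≈ at h (origin u)
      connected root real seam z i (here refl)         = ≈-reflexive (root-connected z i κu)
      connected root real seam z i (there (here refl)) = ≈-trans (≈-reflexive (root-connected z i κv))
        (≈-sym (Tangle.cap (Joiner.acts rootJoiner isEq h real)))
      connected (grow {L} {x} {w} t x∈ w∉ g) real seam = conclude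
        where
        open Leaf t x∈ w∉ g real

        x≢w : x ≢ w
        x≢w = ∈∉⇒≢ x∈ w∉

        lap : ∀ i → at h₁ (w , i) ≈ at h₂ (straight ρ (w , i))
        lap i = ≈-trans (pass-outside t lower i w∉) (seam w i (here refl))

        around : ∀ j → at h₁ (origin w) ≈ at h₂ (strand w (suc j * ρ))
        around zero    = ≈-trans (lap zero) (≈-reflexive (cong (at h₂) (straight-strand ρ w 0)))
        -- At label 0 the strand turns instead of passing; the next label is then reached by a fresh
        -- lap from the origin at `h₁`.
        around (suc j) with strand w (suc j * ρ) ≟ˢ origin w
        ... | yes eq = ≈-trans (lap zero) (≈-reflexive (cong (at h₂) (trans (cong (straight ρ) (sym eq)) (straight-strand ρ w (suc j * ρ)))))
        ... | no ≢₀  = ≈-trans (around j) (≈-trans (through _ (λ eq → x≢w (sym (cong proj₁ eq))) ≢₀)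
                         (≈-trans (lap _) (≈-reflexive (cong (at h₂) (straight-strand ρ w (suc j * ρ))))))

        leaf-connected : ∀ i → at h₂ (w , i) ≈ at h₁ (origin w)
        leaf-connected i with reached ρ coprime w i
        ... | j , eq = ≈-sym (subst (λ σ → at h₁ (origin w) ≈ at h₂ σ) eq (around j))

        pass-inside : ∀ z i → z ∈ L → at h₂ (z , i) ≈ at h₁ (z , i)
        pass-inside z i z∈ with (z , i) ≟ˢ origin x
        ... | yes refl = ≈-trans cup (≈-trans (leaf-connected zero) (≈-sym cap))
        ... | no ≢₀    = through _ ≢₀ (λ eq → w∉ (subst (_∈ L) (cong proj₁ eq) z∈))

        seam′ : Seam L h₁
        seam′ z i z∈ = ≈-trans (seam z i (there z∈)) (pass-inside z _ z∈)

        conclude : ∀ z i → z ∈ w ∷ L → at h (z , i) ≈ at h (origin u)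
        conclude z i (there z∈) = connected t lower seam′ z i z∈
        conclude z i (here refl) with straight-surjective ρ coprime x zero
        ... | k , eq = ≈-trans (seam w i (here refl)) (≈-trans (leaf-connected _) (≈-trans (≈-sym cap)
            (≈-trans (≈-reflexive (cong (at h₁) (sym eq))) (≈-trans (≈-sym (seam′ x k x∈)) (connected t lower seam′ x k x∈)))))

-- Rotations of the circle of residues

module Rotation (p : ℕ) .{{_ : NonZero p}} where

  rotate : ℕ → Fin p → Fin p
  rotate r b = (toℕ b + r) mod p

  toℕ-mod : ∀ m → toℕ (m mod p) ≡ m % p
  toℕ-mod m = Finₚ.toℕ-fromℕ< (m%n<n m p)

  toℕ-mod-< : ∀ {m} → m < p → toℕ (m mod p) ≡ m
  toℕ-mod-< {m} m<p = trans (toℕ-mod m) (m<n⇒m%n≡m m<p)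

  mod-cong : ∀ {m k} → m % p ≡ k % p → m mod p ≡ k mod p
  mod-cong {m} {k} eq = Finₚ.toℕ-injective (trans (toℕ-mod m) (trans eq (sym (toℕ-mod k))))

  mod-toℕ : ∀ b → toℕ b mod p ≡ b
  mod-toℕ b = Finₚ.toℕ-injective (toℕ-mod-< (Finₚ.toℕ<n b))

  rotate-mod : ∀ r m → rotate r (m mod p) ≡ (m + r) mod p
  rotate-mod r m = mod-cong {toℕ (m mod p) + r} {m + r} (begin
    (toℕ (m mod p) + r) % p       ≡⟨ cong (λ k → (k + r) % p) (toℕ-mod m) ⟩
    (m % p + r) % p               ≡⟨ %-distribˡ-+ (m % p) r p ⟩
    (m % p % p + r % p) % p       ≡⟨ cong (λ k → (k + r % p) % p) (m%n%n≡m%n m p) ⟩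
    (m % p + r % p) % p           ≡⟨ %-distribˡ-+ m r p ⟨
    (m + r) % p                   ∎)
    where open ≡-Reasoning

  rotate-rotate : ∀ r s b → rotate s (rotate r b) ≡ rotate (r + s) b
  rotate-rotate r s b = trans (rotate-mod s (toℕ b + r)) (cong (_mod p) (+-assoc (toℕ b) r s))

  rotate-p : ∀ b → rotate p b ≡ b
  rotate-p b = trans (mod-cong {toℕ b + p} {toℕ b} (%-remove-+ʳ (toℕ b) (∣-refl {p}))) (mod-toℕ b)

  rotate-inverse : ∀ {r} → r ≤ p → ∀ b → rotate (p ∸ r) (rotate r b) ≡ b
  rotate-inverse {r} r≤p b = trans (rotate-rotate r (p ∸ r) b)
    (trans (cong (λ m → rotate m b) (m+[n∸m]≡n r≤p)) (rotate-p b))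

  rotate-inverse′ : ∀ {r} → r ≤ p → ∀ b → rotate r (rotate (p ∸ r) b) ≡ b
  rotate-inverse′ {r} r≤p b = trans (rotate-rotate (p ∸ r) r b)
    (trans (cong (λ m → rotate m b) (m∸n+n≡m r≤p)) (rotate-p b))

  rotate-fixed-free : ∀ {r} → 0 < r → r < p → ∀ b → rotate r b ≢ b
  rotate-fixed-free {r} 0<r r<p b eq = <⇒≢ 0<r (sym (trans (sym (m<n⇒m%n≡m r<p)) r%p≡0))
    where
    r%p≡0 : r % p ≡ 0
    r%p≡0 = trans (+-cancel-% p (toℕ b) r 0 (begin
        (toℕ b + r) % p    ≡⟨ toℕ-mod (toℕ b + r) ⟨
        toℕ (rotate r b)   ≡⟨ cong toℕ eq ⟩
        toℕ b              ≡⟨ m<n⇒m%n≡m (Finₚ.toℕ<n b) ⟨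
        toℕ b % p          ≡⟨ cong (_% p) (+-identityʳ (toℕ b)) ⟨
        (toℕ b + 0) % p    ∎))
      (m<n⇒m%n≡m (≤-trans (s≤s z≤n) r<p))
      where open ≡-Reasoning

-- The 2-factor of the lift given by a box

module Factor {n : ℕ} (κ : Fin n → ℕ) (G : Fin n → Fin n → Set)
  (G-sym : ∀ {x y} → G x y → G y x) (G-irrefl : ∀ {x} → ¬ G x x)
  (B : Boxes.Box κ G G-sym G-irrefl) (p : ℕ) .{{_ : NonZero p}}
  (large : Boxes.Box.len B + (Strands.Λ κ + Strands.Λ κ) < p) where

  open Strands κ
  open Boxes κ G G-sym G-irrefl
  open Box B
  open Rotation p

  len<p : len < p
  len<p = ≤-trans (s≤s (m≤m+n len (Λ + Λ))) large

  -- Keeps the loop neighbours above and below a node distinct.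
  2φ<p : ∀ z → φ z + φ z < p
  2φ<p z = ≤-trans (s≤s (≤-trans (+-mono-≤ (φ≤Λ z) (φ≤Λ z)) (m≤n+m (Λ + Λ) len))) large

  φ<p : ∀ z → φ z < p
  φ<p z = ≤-trans (s≤s (m≤m+n (φ z) (φ z))) (2φ<p z)

  V : Set
  V = Fin n × Fin p

  -- The lift for trivial voltages on the tree edges.
  Adjacent : V → V → Set
  Adjacent (x , a) (y , b) = (G x y × a ≡ b) ⊎ (x ≡ y × (b ≡ rotate (φ x) a ⊎ a ≡ rotate (φ x) b))

  -- A rung takes the slot of the loop edge it replaces: the upper one at a `top`, the lower one at
  -- a `bot`.
  upper lower : Status → Fin n → Fin p → V
  upper (top y) x b = y , b
  upper free    x b = x , rotate (φ x) b
  upper (bot _) x b = x , rotate (φ x) b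
  lower (bot y) x b = y , b
  lower free    x b = x , rotate (p ∸ φ x) b
  lower (top _) x b = x , rotate (p ∸ φ x) b

  locᶠ : Fin n → Fin p → Status
  locᶠ x b = loc x (toℕ b)

  nbr : V → Bool → V
  nbr (x , b) true  = upper (locᶠ x b) x b
  nbr (x , b) false = lower (locᶠ x b) x b

  G⇒≢ : ∀ {x y} → G x y → x ≢ y
  G⇒≢ g refl = G-irrefl g

  nbr-adjacent : ∀ v i → Adjacent v (nbr v i)
  nbr-adjacent (x , b) true with locᶠ x b in eq
  ... | top y = inj₁ (proj₁ (rung x (toℕ b) (inj₁ eq)) , refl)
  ... | free  = inj₂ (refl , inj₁ refl)
  ... | bot _ = inj₂ (refl , inj₁ refl)
  nbr-adjacent (x , b) false with locᶠ x b in eq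
  ... | bot y = inj₁ (proj₁ (rung x (toℕ b) (inj₂ eq)) , refl)
  ... | free  = inj₂ (refl , inj₂ (sym (rotate-inverse′ (<⇒≤ (φ<p x)) b)))
  ... | top _ = inj₂ (refl , inj₂ (sym (rotate-inverse′ (<⇒≤ (φ<p x)) b)))

  rung-back : ∀ {x b y} → Rung (locᶠ x b) y → ∃ λ j → nbr (y , b) j ≡ (x , b)
  rung-back {x} {b} {y} ρ with proj₂ (rung x (toℕ b) ρ)
  ... | inj₁ eq = true  , cong (λ s → upper s y b) eq
  ... | inj₂ eq = false , cong (λ s → lower s y b) eq

  lower-loop : ∀ {s x b} → (∀ y → s ≢ bot y) → lower s x b ≡ (x , rotate (p ∸ φ x) b)
  lower-loop {free}  _  = refl
  lower-loop {top _} _  = refl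
  lower-loop {bot y} ¬b = ⊥-elim (¬b y refl)

  upper-loop : ∀ {s x b} → (∀ y → s ≢ top y) → upper s x b ≡ (x , rotate (φ x) b)
  upper-loop {free}  _  = refl
  upper-loop {bot _} _  = refl
  upper-loop {top y} ¬t = ⊥-elim (¬t y refl)

  -- No removed edge wraps around: if `toℕ b + φ x` reaches `p`, the rotated height is below `φ x`,
  -- whereas a `bot` has height at least `φ x`.
  rotate-bot : ∀ x b {y} → locᶠ x (rotate (φ x) b) ≡ bot y → locᶠ x b ≡ top y
  rotate-bot x b {y} eq with bot-top x _ eq
  ... | c , c+φ≡ , eq′ = subst (λ d → loc x d ≡ top y) (sym b≡c) eq′
    where
    b≡c : toℕ b ≡ c
    b≡c with toℕ b + φ x <? p
    ... | yes b+φ<p = +-cancelʳ-≡ (φ x) (toℕ b) c (trans (sym (toℕ-mod-< b+φ<p)) c+φ≡)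
    ... | no b+φ≮p = ⊥-elim (<⇒≱ rotate<φ (≤-trans (m≤n+m (φ x) c) (≤-reflexive (sym c+φ≡))))
      where
      excess = toℕ b + φ x ∸ p
      p+excess : p + excess ≡ toℕ b + φ x
      p+excess = m+[n∸m]≡n (≮⇒≥ b+φ≮p)
      excess<φ : excess < φ x
      excess<φ = +-cancelˡ-< p excess (φ x) (subst (_< p + φ x) (sym p+excess) (+-monoˡ-< (φ x) (Finₚ.toℕ<n b)))
      rotate≡ : toℕ (rotate (φ x) b) ≡ excess
      rotate≡ = trans (toℕ-mod (toℕ b + φ x)) (trans (cong (_% p) (sym p+excess))
        (trans (%-remove-+ˡ excess (∣-refl {p})) (m<n⇒m%n≡m (<-trans excess<φ (φ<p x)))))
      rotate<φ : toℕ (rotate (φ x) b) < φ x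
      rotate<φ = subst (_< φ x) (sym rotate≡) excess<φ

  rotate-top : ∀ x b {y} → locᶠ x b ≡ top y → locᶠ x (rotate (φ x) b) ≡ bot y
  rotate-top x b {y} eq with top-bot x (toℕ b) eq
  ... | lt , eq′ = trans (cong (loc x) (toℕ-mod-< (<-trans lt len<p))) eq′

  up-down : ∀ x b → (∀ y → locᶠ x b ≢ top y) → nbr (x , rotate (φ x) b) false ≡ (x , b)
  up-down x b ¬t = trans (lower-loop (λ y eq → ¬t y (rotate-bot x b eq)))
    (cong (x ,_) (rotate-inverse (<⇒≤ (φ<p x)) b))

  down-up : ∀ x b → (∀ y → locᶠ x b ≢ bot y) → nbr (x , rotate (p ∸ φ x) b) true ≡ (x , b)
  down-up x b ¬b = trans (upper-loop (λ y eq → ¬b y (trans (cong (locᶠ x) (sym back)) (rotate-top x _ eq)))) (cong (x ,_) back)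
    where
    back : rotate (φ x) (rotate (p ∸ φ x) b) ≡ b
    back = rotate-inverse′ (<⇒≤ (φ<p x)) b

  nbr-sym : ∀ v i → ∃ λ j → nbr (nbr v i) j ≡ v
  nbr-sym (x , b) true with locᶠ x b in eq
  ... | top y = rung-back (inj₁ eq)
  ... | free  = false , up-down x b (λ y eq′ → case trans (sym eq) eq′ of λ ())
  ... | bot _ = false , up-down x b (λ y eq′ → case trans (sym eq) eq′ of λ ())
  nbr-sym (x , b) false with locᶠ x b in eq
  ... | bot y = rung-back (inj₂ eq)
  ... | free  = true , down-up x b (λ y eq′ → case trans (sym eq) eq′ of λ ())
  ... | top _ = true , down-up x b (λ y eq′ → case trans (sym eq) eq′ of λ ())

  nbr-distinct : ∀ v → nbr v true ≢ nbr v false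
  nbr-distinct (x , b) with locᶠ x b in eq
  ... | top y = λ eq′ → G⇒≢ (proj₁ (rung x (toℕ b) (inj₁ eq))) (sym (cong proj₁ eq′))
  ... | bot y = λ eq′ → G⇒≢ (proj₁ (rung x (toℕ b) (inj₂ eq))) (cong proj₁ eq′)
  ... | free  = λ eq′ → rotate-fixed-free (s≤s z≤n) (2φ<p x) b (begin
      rotate (φ x + φ x) b                   ≡⟨ rotate-rotate (φ x) (φ x) b ⟨
      rotate (φ x) (rotate (φ x) b)          ≡⟨ cong (rotate (φ x)) (cong proj₂ eq′) ⟩
      rotate (φ x) (rotate (p ∸ φ x) b)      ≡⟨ rotate-inverse′ (<⇒≤ (φ<p x)) b ⟩
      b                                      ∎)
      where open ≡-Reasoning

  nbr-irrefl : ∀ v i → nbr v i ≢ v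
  nbr-irrefl (x , b) true with locᶠ x b in eq
  ... | top y = λ eq′ → G⇒≢ (proj₁ (rung x (toℕ b) (inj₁ eq))) (sym (cong proj₁ eq′))
  ... | free  = λ eq′ → rotate-fixed-free (s≤s z≤n) (φ<p x) b (cong proj₂ eq′)
  ... | bot _ = λ eq′ → rotate-fixed-free (s≤s z≤n) (φ<p x) b (cong proj₂ eq′)
  nbr-irrefl (x , b) false with locᶠ x b in eq
  ... | bot y = λ eq′ → G⇒≢ (proj₁ (rung x (toℕ b) (inj₂ eq))) (sym (cong proj₁ eq′))
  ... | free  = λ eq′ → rotate-fixed-free (m<n⇒0<n∸m (φ<p x)) (∸-monoʳ-< (s≤s z≤n) (<⇒≤ (φ<p x))) b (cong proj₂ eq′)
  ... | top _ = λ eq′ → rotate-fixed-free (m<n⇒0<n∸m (φ<p x)) (∸-monoʳ-< (s≤s z≤n) (<⇒≤ (φ<p x))) b (cong proj₂ eq′)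

  side : Bool → Fin 2
  side true  = zero
  side false = suc zero

  side-injective : InjectiveFn side
  side-injective {true}  {true}  _ = refl
  side-injective {false} {false} _ = refl

  dartIndex : V × Bool → Fin (n * p * 2)
  dartIndex ((x , b) , i) = Fin.combine (Fin.combine x b) (side i)

  dartIndex-injective : InjectiveFn dartIndex
  dartIndex-injective {(x , b) , i} {(y , c) , j} eq
    with Finₚ.combine-injective (Fin.combine x b) (side i) (Fin.combine y c) (side j) eq
  ... | eq₁ , eq₂ with Finₚ.combine-injective x b y c eq₁ | side-injective eq₂
  ...   | refl , refl | refl = refl

  open TwoRegular (≡-dec Fin._≟_ Fin._≟_) dartIndex dartIndex-injective Adjacent nbr nbr-adjacent
    nbr-sym nbr-distinct nbr-irrefl public using (Link; connected⇒hamiltonian)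

  project : Node → V
  project (x , b) = x , b mod p

  _≈_ : Node → Node → Set
  a ≈ b = EqClosure Link (project a) (project b)

  ≈-isEquivalence : IsEquivalence _≈_
  ≈-isEquivalence = On.isEquivalence project (EqClosure-isEquivalence Link)

  link : ∀ {a b} i → nbr (project a) i ≡ project b → a ≈ b
  link i eq = fwd (i , eq) ◅ ε

  loc-project : ∀ x {d} → d < p → locᶠ x (d mod p) ≡ loc x d
  loc-project x d<p = cong (loc x) (toℕ-mod-< d<p)

  loop-≈ : ∀ x d → d < p → (∀ y → loc x d ≢ top y) → (x , d) ≈ (x , d + φ x)
  loop-≈ x d d<p ¬t = link true (trans (upper-loop (λ y eq → ¬t y (trans (sym (loc-project x d<p)) eq)))
    (cong (x ,_) (rotate-mod (φ x) d)))

  realises : Realises _≈_ B 0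
  realises = record
    { loop-edge = λ x d d<len → loop-≈ x d (<-trans d<len len<p)
    ; rung-edge = λ x d d<len → rung-≈ x d (<-trans d<len len<p)
    }
    where
    rung-≈ : ∀ x d {y} → d < p → Rung (loc x d) y → (x , d) ≈ (y , d)
    rung-≈ x d d<p (inj₁ eq) = link true  (cong (λ s → upper s x (d mod p)) (trans (loc-project x d<p) eq))
    rung-≈ x d d<p (inj₂ eq) = link false (cong (λ s → lower s x (d mod p)) (trans (loc-project x d<p) eq))

  loop-beyond : ∀ x c → len + c < p → (x , len + c) ≈ (x , len + (c + φ x))
  loop-beyond x c lt = subst (λ m → (x , len + c) ≈ (x , m)) (+-assoc len c (φ x))
    (loop-≈ x (len + c) lt (λ y eq → <⇒≱ (proj₁ (top-bot x (len + c) eq)) (≤-trans (m≤m+n len c) (m≤m+n (len + c) (φ x)))))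

  wrap : ∀ x b → (x , p + b) ≈ (x , b)
  wrap x b = IsEquivalence.reflexive (EqClosure-isEquivalence Link)
    (cong (x ,_) (mod-cong {p + b} {b} (%-remove-+ˡ b (∣-refl {p}))))

-- Hamiltonicity for trivial tree voltages

module TrivialVoltages {n : ℕ} (κ : Fin n → ℕ) (G : Fin n → Fin n → Set)
  (G-sym : ∀ {x y} → G x y → G y x) (G-irrefl : ∀ {x} → ¬ G x x)
  (u v : Fin n) (Guv : G u v) (κu : κ u ≡ 0) (κv : κ v ≡ 0)
  {L : List (Fin n)} (t : Growth G u v L) (complete : ∀ z → z ∈ L)
  (p : ℕ) (p-prime : Prime p) .{{_ : NonZero p}}
  (large : Assembly.size κ G G-sym G-irrefl u v Guv κu κv t + (Strands.Λ κ + Strands.Λ κ) < p) where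

  open Strands κ
  open Joiners κ G G-sym G-irrefl
  open Assembly κ G G-sym G-irrefl u v Guv κu κv
  open Factor κ G G-sym G-irrefl (assembly t) p large
  open IsEquivalence ≈-isEquivalence renaming (refl to ≈-refl; sym to ≈-sym; trans to ≈-trans; reflexive to ≈-reflexive)

  height ρ : ℕ
  height = size t
  -- The length of the part of the circle above the stack.
  ρ = p ∸ height

  height+ρ : height + ρ ≡ p
  height+ρ = m+[n∸m]≡n (<⇒≤ len<p)

  -- A common divisor divides `Λ`, hence the height of the stack, hence `p`, which is prime and
  -- larger than `φ z`.
  ρ-coprime : ∀ z → Coprime ρ (φ z)
  ρ-coprime z {d} (d∣ρ , d∣φ) = prime⇒coprime p-prime (φ<p z)
    (subst (d ∣_) height+ρ (∣m∣n⇒∣m+n (∣-trans d∣φ (∣-trans (φ∣Λ z) (Λ∣size t))) d∣ρ) , d∣φ)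

  -- Reading height 0 as `p` and descending over the part of the circle without boxes leads to the
  -- top of the stack.
  seam : ∀ z i → at 0 (z , i) ≈ at height (straight ρ (z , i))
  seam z i = ≈-trans (≈-sym (wrap z (toℕ i))) (≈-trans
    (≈-reflexive (cong (z ,_) (trans (cong (_+ toℕ i) (sym height+ρ)) (+-assoc height ρ (toℕ i)))))
    (descend ≈-isEquivalence height z (ρ + toℕ i) (λ c le _ → loop-beyond z c
      (subst (height + c <_) height+ρ (+-monoʳ-< height (below-top {z} i le))))))

  base : Node
  base = at 0 (origin u)

  bottom : ∀ σ → at 0 σ ≈ base
  bottom (z , i) = connected ≈-isEquivalence 0 ρ ρ-coprime t realises (λ z i _ → seam z i) z i (complete z)

  ceiling : ∀ σ → at height σ ≈ base
  ceiling (z , i) with straight-surjective ρ ρ-coprime z i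
  ... | k , eq = ≈-trans (≈-reflexive (cong (at height) (sym eq))) (≈-trans (≈-sym (seam z k)) (bottom (z , k)))

  everywhere : ∀ x b → b < p → (x , b) ≈ base
  everywhere x b b<p with b <? height
  ... | yes b<height with cover-assembly ≈-isEquivalence 0 t realises x b z≤n b<height
  ...   | σ , inj₁ q = ≈-trans q (bottom σ)
  ...   | σ , inj₂ q = ≈-trans q (ceiling σ)
  everywhere x b b<p | no b≮height = ≈-trans (≈-reflexive (cong (x ,_) (sym eq)))
      (≈-trans (descend ≈-isEquivalence height x (b ∸ height) (λ c le _ → loop-beyond x c
        (≤-trans (s≤s (≤-trans (+-monoʳ-≤ height (≤-trans (m≤m+n c (φ x)) le)) (≤-reflexive eq))) b<p))) (ceiling _))
    where
    eq : height + (b ∸ height) ≡ b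
    eq = m+[n∸m]≡n (≮⇒≥ b≮height)

  hamiltonian : Hamiltonian Adjacent
  hamiltonian = connected⇒hamiltonian (project base) (λ { (x , b) →
    subst (λ c → EqClosure Link (project base) (x , c)) (Rotation.mod-toℕ p b) (≈-sym (everywhere x (toℕ b) (Finₚ.toℕ<n b))) })

-- Integer congruences modulo p

open import Data.Integer using (+_; _>_)
open Signed using () renaming (_∣_ to _∣ₛ_)

module Congruence (p : ℕ) .{{_ : NonZero p}} where

  open ℤ-Solver

  infix 4 _≋_

  _≋_ : ℤ → ℤ → Set
  a ≋ b = + p ∣ₛ a ℤ.- b

  ≋-sym : ∀ a b → a ≋ b → b ≋ a
  ≋-sym a b d = subst (+ p ∣ₛ_) (solve 2 (λ a b → :- (a :- b) := b :- a) refl a b) (Signed.∣m⇒∣-m d)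

  ≋-trans : ∀ a b c → a ≋ b → b ≋ c → a ≋ c
  ≋-trans a b c d e =
    subst (+ p ∣ₛ_) (solve 3 (λ a b c → (a :- b) :+ (b :- c) := a :- c) refl a b c) (Signed.∣m∣n⇒∣m+n d e)

  ≋-+ʳ : ∀ a b c → a ≋ b → a ℤ.+ c ≋ b ℤ.+ c
  ≋-+ʳ a b c = subst (+ p ∣ₛ_) (solve 3 (λ a b c → a :- b := (a :+ c) :- (b :+ c)) refl a b c)

  ≋-+ʳ⁻¹ : ∀ a b c → a ℤ.+ c ≋ b ℤ.+ c → a ≋ b
  ≋-+ʳ⁻¹ a b c = subst (+ p ∣ₛ_) (solve 3 (λ a b c → (a :+ c) :- (b :+ c) := a :- b) refl a b c)

  residue : ℤ → Fin p
  residue a = fromℕ< (n%ℕd<d a p)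

  residue-≋ : ∀ a → a ≋ + toℕ (residue a)
  residue-≋ a rewrite Finₚ.toℕ-fromℕ< (n%ℕd<d a p) = Signed.divides (a /ℕ p) (begin
    a ℤ.- + (a %ℕ p)                                        ≡⟨ cong (ℤ._- + (a %ℕ p)) (a≡a%ℕn+[a/ℕn]*n a p) ⟩
    + (a %ℕ p) ℤ.+ (a /ℕ p) ℤ.* + p ℤ.- + (a %ℕ p)          ≡⟨ solve 2 (λ r m → r :+ m :- r := m) refl (+ (a %ℕ p)) ((a /ℕ p) ℤ.* + p) ⟩
    (a /ℕ p) ℤ.* + p                                        ∎)
    where open ≡-Reasoning

  mod-≋ : ∀ m → + toℕ (m mod p) ≋ + m
  mod-≋ m = ≋-sym (+ m) (+ toℕ (m mod p)) (Signed.divides (+ (m / p)) (begin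
    + m ℤ.- + toℕ (m mod p)                      ≡⟨ cong (λ k → + m ℤ.- + k) (Rotation.toℕ-mod p m) ⟩
    + m ℤ.- + (m % p)                            ≡⟨ cong (λ k → + k ℤ.- + (m % p)) (m≡m%n+[m/n]*n m p) ⟩
    + (m % p + m / p * p) ℤ.- + (m % p) ≡⟨ cong (λ k → + (m % p) ℤ.+ k ℤ.- + (m % p)) (ℤₚ.pos-* (m / p) p) ⟩
    + (m % p) ℤ.+ + (m / p) ℤ.* + p ℤ.- + (m % p) ≡⟨ solve 2 (λ r m → r :+ m :- r := m) refl (+ (m % p)) (+ (m / p) ℤ.* + p) ⟩
    + (m / p) ℤ.* + p                            ∎))
    where open ≡-Reasoning

  -- The difference of two residues is smaller than `p` in absolute value, so it vanishes if `p`
  -- divides it.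
  ≋⇒≡ : ∀ (a b : Fin p) → + toℕ a ≋ + toℕ b → a ≡ b
  ≋⇒≡ a b d = Finₚ.toℕ-injective (ℤₚ.+-injective (ℤₚ.i-j≡0⇒i≡j (+ toℕ a) (+ toℕ b) (ℤₚ.∣i∣≡0⇒i≡0 (vanish _ refl))))
    where
    difference = + toℕ a ℤ.- + toℕ b
    small : ℤ.∣ difference ∣ < p
    small = subst (λ i → ℤ.∣ i ∣ < p) (sym (ℤₚ.[+m]-[+n]≡m⊖n (toℕ a) (toℕ b)))
      (≤-<-trans (ℤₚ.∣m⊝n∣≤m⊔n (toℕ a) (toℕ b)) (⊔-lub (Finₚ.toℕ<n a) (Finₚ.toℕ<n b)))
    vanish : ∀ m → ℤ.∣ difference ∣ ≡ m → ℤ.∣ difference ∣ ≡ 0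
    vanish zero    eq = eq
    vanish (suc m) eq = ⊥-elim (<⇒≱ small (subst (p ≤_) (sym eq)
      (∣⇒≤ (subst (p ∣_) eq (Signed.∣⇒∣ᵤ d)))))

-- Spanning tree, potential and change of gauge

transport-hamiltonian : ∀ {V W : Set} {R : V → V → Set} {S : W → W → Set} (ψ : V → W) →
  InjectiveFn ψ → (∀ w → ∃ λ v → ψ v ≡ w) → (∀ {a b} → R a b → S (ψ a) (ψ b)) →
  Hamiltonian R → Hamiltonian S
transport-hamiltonian ψ inj surj hom (k , c , cycle , covers) = k , ψ ∘ c , record
  { long     = long
  ; distinct = λ i j eq → distinct i j (inj eq)
  ; steps    = λ i → hom (steps i)
  ; closing  = hom closing
  } , λ w → let v , eq = surj w ; i , eq′ = covers v in i , trans (cong ψ eq′) eq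
  where open IsCycle cycle

update : ∀ {n} → Fin n → ℤ → (Fin n → ℤ) → Fin n → ℤ
update w a q z with z Fin.≟ w
... | yes _ = a
... | no _  = q z

update-same : ∀ {n} (w : Fin n) a q → update w a q w ≡ a
update-same w a q with w Fin.≟ w
... | yes _ = refl
... | no ¬p = ⊥-elim (¬p refl)

update-other : ∀ {n} (w : Fin n) a q {z} → z ≢ w → update w a q z ≡ q z
update-other w a q {z} z≢w with z Fin.≟ w
... | yes p = ⊥-elim (z≢w p)
... | no _  = refl

module _ (T : WeightedReflexiveTree) where

  open WeightedReflexiveTree T
  open DecMembership (Fin._≟_ {n}) using (_∈?_)

  -- The tree edges whose voltage is the difference of the potential `q` at their ends; shifting the
  -- fibres by `q` makes it vanish.
  Balanced : (Fin n → ℤ) → Fin n → Fin n → Set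
  Balanced q x y = Adj x y × q y ≡ q x ℤ.+ arcφ x y

  balanced-sym : ∀ q {x y} → Balanced q x y → Balanced q y x
  balanced-sym q {x} {y} (e , eq) = IsTree.sym tree e , (begin
    q x                                     ≡⟨ solve 2 (λ a b → a := a :+ b :+ :- b) refl (q x) (arcφ x y) ⟩
    q x ℤ.+ arcφ x y ℤ.+ ℤ.- arcφ x y       ≡⟨ cong₂ ℤ._+_ eq (antisym e) ⟨
    q y ℤ.+ arcφ y x                        ∎)
    where
    open ≡-Reasoning
    open ℤ-Solver

  balanced-irrefl : ∀ q {x} → ¬ Balanced q x x
  balanced-irrefl q (e , _) = IsTree.irrefl tree e

  module _ {u v : Fin n} where

    -- Along the walk, each vertex not yet present is attached as a leaf to its predecessor.
    extend : ∀ {L x y} → Growth Adj u v L → x ∈ L → Walk Adj x y →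
      ∃ λ L′ → Growth Adj u v L′ × (∀ {z} → z ∈ L → z ∈ L′) × y ∈ L′
    extend {L} t x∈ [] = L , t , id , x∈
    extend {L} t x∈ (_∷_ {y = y} e walk) with y ∈? L
    ... | yes y∈ = extend t y∈ walk
    ... | no  y∉ = let L′ , t′ , ⊆ , z∈ = extend (grow t x∈ y∉ e) (here refl) walk in L′ , t′ , ⊆ ∘ there , z∈

    root∈ : ∀ {L} → Growth Adj u v L → u ∈ L
    root∈ root             = here refl
    root∈ (grow t _ _ _) = there (root∈ t)

    spanning : ∃ λ L → Growth Adj u v L × (∀ z → z ∈ L)
    spanning = let L , t , all = collect (allFin n) in L , t , λ z → all (∈-allFin z)
      where
      collect : ∀ zs → ∃ λ L → Growth Adj u v L × (∀ {z} → z ∈ zs → z ∈ L)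
      collect []       = u ∷ v ∷ [] , root , λ ()
      collect (y ∷ zs) with collect zs
      ... | L , t , all with extend t (root∈ t) (IsTree.connected tree u y)
      ...   | L′ , t′ , ⊆ , y∈ = L′ , t′ , λ { (here refl) → y∈ ; (there z∈) → ⊆ (all z∈) }

    -- The sum of the voltages along the tree path from `u`, with default 0 outside `L`.
    potential : ∀ {L} → Growth Adj u v L → Fin n → ℤ
    potential root = update v (arcφ u v) (λ _ → + 0)
    potential (grow {x = x} {w = w} t _ _ _) = update w (potential t x ℤ.+ arcφ x w) (potential t)

    -- Stated for any `q` agreeing with the potential on `L`, because the recursion shortens the
    -- tree while `q` remains the potential of the whole one.
    rebalance : ∀ {L} (t : Growth Adj u v L) (q : Fin n → ℤ) → (∀ {z} → z ∈ L → q z ≡ potential t z) →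
      Growth (Balanced q) u v L
    rebalance root q agree = root
    rebalance (grow {L} {x} {w} t x∈ w∉ e) q agree = grow (rebalance t q agree′) x∈ w∉ (e , (begin
      q w                       ≡⟨ agree (here refl) ⟩
      potential (grow t x∈ w∉ e) w ≡⟨ update-same w _ (potential t) ⟩
      potential t x ℤ.+ arcφ x w ≡⟨ cong (ℤ._+ arcφ x w) (agree′ x∈) ⟨
      q x ℤ.+ arcφ x w          ∎))
      where
      open ≡-Reasoning
      agree′ : ∀ {z} → z ∈ L → q z ≡ potential t z
      agree′ z∈ = trans (agree (there z∈)) (update-other w _ (potential t) λ { refl → w∉ z∈ })

    root-balanced : Adj u v → ∀ {L} (t : Growth Adj u v L) (q : Fin n → ℤ) → (∀ {z} → z ∈ L → q z ≡ potential t z) →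
      Balanced q u v
    root-balanced e root q agree = e , (begin
      q v                 ≡⟨ agree (there (here refl)) ⟩
      potential root v    ≡⟨ update-same v _ _ ⟩
      arcφ u v            ≡⟨ ℤₚ.+-identityˡ (arcφ u v) ⟨
      + 0 ℤ.+ arcφ u v    ≡⟨ cong (ℤ._+ arcφ u v) (update-other v (arcφ u v) (λ _ → + 0) {u} (λ { refl → IsTree.irrefl tree e })) ⟨
      potential root u ℤ.+ arcφ u v ≡⟨ cong (ℤ._+ arcφ u v) (agree (here refl)) ⟨
      q u ℤ.+ arcφ u v    ∎)
      where open ≡-Reasoning
    root-balanced e (grow {L} {x} {w} t x∈ w∉ _) q agree = root-balanced e t q
      (λ z∈ → trans (agree (there z∈)) (update-other w _ (potential t) λ { refl → w∉ z∈ }))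

  module Gauge (q : Fin n → ℤ) (p : ℕ) .{{_ : NonZero p}} where

    open Congruence p
    open Rotation p
    open ℤ-Solver

    position : Fin n → Fin p → Fin p
    position x b = residue (+ toℕ b ℤ.+ q x)

    position-≋ : ∀ x b → + toℕ b ℤ.+ q x ≋ + toℕ (position x b)
    position-≋ x b = residue-≋ (+ toℕ b ℤ.+ q x)

    gauge : Fin n × Fin p → Fin n × Fin p
    gauge (x , b) = x , position x b

    gauge-injective : InjectiveFn gauge
    gauge-injective {x , b} {y , c} eq with cong proj₁ eq
    ... | refl = cong (x ,_) (≋⇒≡ b c (≋-+ʳ⁻¹ (+ toℕ b) (+ toℕ c) (q x)
      (≋-trans (+ toℕ b ℤ.+ q x) (+ toℕ (position x b)) (+ toℕ c ℤ.+ q x) (position-≋ x b)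
        (subst (λ r → + toℕ r ≋ + toℕ c ℤ.+ q x) (sym (cong proj₂ eq))
          (≋-sym (+ toℕ c ℤ.+ q x) (+ toℕ (position x c)) (position-≋ x c))))))

    gauge-surjective : ∀ w → ∃ λ v → gauge v ≡ w
    gauge-surjective (x , a) = (x , b) , cong (x ,_) (≋⇒≡ (position x b) a
        (≋-trans (+ toℕ (position x b)) (+ toℕ b ℤ.+ q x) (+ toℕ a)
          (≋-sym (+ toℕ b ℤ.+ q x) (+ toℕ (position x b)) (position-≋ x b))
          (subst (+ toℕ b ℤ.+ q x ≋_) (solve 2 (λ a q → (a :- q) :+ q := a) refl (+ toℕ a) (q x))
            (≋-+ʳ (+ toℕ b) (+ toℕ a ℤ.- q x) (q x)
              (≋-sym (+ toℕ a ℤ.- q x) (+ toℕ b) (residue-≋ (+ toℕ a ℤ.- q x)))))))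
      where b = residue (+ toℕ a ℤ.- q x)

    rotate-voltage : ∀ r x b → + r ≋ + toℕ (position x (rotate r b)) ℤ.- + toℕ (position x b)
    rotate-voltage r x b = subst (+ p ∣ₛ_)
      (solve 6 (λ r b c q b′ c′ → (c :+ q :- c′) :- (b :+ q :- b′) :+ :- (c :- (b :+ r)) := r :- (c′ :- b′)) refl
        (+ r) (+ toℕ b) (+ toℕ (rotate r b)) (q x) (+ toℕ (position x b)) (+ toℕ (position x (rotate r b))))
      (Signed.∣m∣n⇒∣m+n (Signed.∣m∣n⇒∣m-n (position-≋ x (rotate r b)) (position-≋ x b))
        (Signed.∣m⇒∣-m (mod-≋ (toℕ b + r))))

    arc-voltage : ∀ {x y} → q y ≡ q x ℤ.+ arcφ x y → ∀ b →
      arcφ x y ≋ + toℕ (position y b) ℤ.- + toℕ (position x b)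
    arc-voltage {x} {y} eq b = subst (+ p ∣ₛ_) (begin
      (b′ ℤ.+ q y ℤ.- c₂) ℤ.- (b′ ℤ.+ q x ℤ.- c₁)                 ≡⟨ cong (λ a → (b′ ℤ.+ a ℤ.- c₂) ℤ.- (b′ ℤ.+ q x ℤ.- c₁)) eq ⟩
      (b′ ℤ.+ (q x ℤ.+ arcφ x y) ℤ.- c₂) ℤ.- (b′ ℤ.+ q x ℤ.- c₁)  ≡⟨ solve 5 (λ b q a c₁ c₂ → (b :+ (q :+ a) :- c₂) :- (b :+ q :- c₁) := a :- (c₂ :- c₁)) refl b′ (q x) (arcφ x y) c₁ c₂ ⟩
      arcφ x y ℤ.- (c₂ ℤ.- c₁)                                    ∎)
      (Signed.∣m∣n⇒∣m-n (position-≋ y b) (position-≋ x b))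
      where
      open ≡-Reasoning
      b′ = + toℕ b
      c₁ = + toℕ (position x b)
      c₂ = + toℕ (position y b)

    module _ (κ : Fin n → ℕ) (loop≡ : ∀ w → loopφ w ≡ + suc (κ w)) where

      -- Along a balanced edge the height is constant before the gauge and changes by `q y` - `q x`,
      -- the voltage, after it; inside a fibre the shift by `q x` cancels.
      gauge-adjacent : ∀ {x y a b} →
        (Balanced q x y × a ≡ b) ⊎ (x ≡ y × (b ≡ rotate (suc (κ x)) a ⊎ a ≡ rotate (suc (κ x)) b)) →
        LiftAdj T p (gauge (x , a)) (gauge (y , b))
      gauge-adjacent {a = a} (inj₁ ((e , eq) , refl)) = inj₁ (e , Signed.∣⇒∣ᵤ (arc-voltage eq a))
      gauge-adjacent {x} {a = a} (inj₂ (refl , inj₁ refl)) = inj₂ (refl , inj₁ (Signed.∣⇒∣ᵤ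
        (subst (_≋ + toℕ (position x (rotate (suc (κ x)) a)) ℤ.- + toℕ (position x a)) (sym (loop≡ x)) (rotate-voltage (suc (κ x)) x a))))
      gauge-adjacent {x} {b = b} (inj₂ (refl , inj₂ refl)) = inj₂ (refl , inj₂ (Signed.∣⇒∣ᵤ
        (subst (λ l → ℤ.- l ≋ c₁ ℤ.- c₂) (sym (loop≡ x)) (subst (+ p ∣ₛ_)
          (solve 3 (λ r c b → :- (r :- (c :- b)) := :- r :- (b :- c)) refl (+ suc (κ x)) c₂ c₁)
          (Signed.∣m⇒∣-m (rotate-voltage (suc (κ x)) x b))))))
        where
        c₁ = + toℕ (position x b)
        c₂ = + toℕ (position x (rotate (suc (κ x)) b))

theorem4 : (T : WeightedReflexiveTree) →
    (∀ w → WeightedReflexiveTree.loopφ T w > + 0) →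
    (∀ u v → WeightedReflexiveTree.Adj T u v → WeightedReflexiveTree.loopφ T u ≡ + 1 → WeightedReflexiveTree.loopφ T v ≡ + 1 →
    Σ ℕ λ N → ∀ p → Prime p → N ≤ p → Hamiltonian (LiftAdj T p))
theorem4 T positive u v Auv loopu loopv with spanning T {u} {v}
-- The bound leaves room on the circle for the stack of boxes and, beyond it, for twice any loop
-- value.
... | L , t , complete = suc (Assembly.size κ G G-sym G-irrefl u v Guv κu κv t′ + (Strands.Λ κ + Strands.Λ κ)) , lift
  where
  open WeightedReflexiveTree T
  κ : Fin n → ℕ
  κ w = pred ℤ.∣ loopφ w ∣
  pred-suc : ∀ {i} → i > + 0 → i ≡ + suc (pred ℤ.∣ i ∣)
  pred-suc (ℤ.+<+ (s≤s z≤n)) = refl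
  κu : κ u ≡ 0
  κu = cong (λ i → pred ℤ.∣ i ∣) loopu
  κv : κ v ≡ 0
  κv = cong (λ i → pred ℤ.∣ i ∣) loopv
  q : Fin n → ℤ
  q = potential T t
  G : Fin n → Fin n → Set
  G = Balanced T q
  G-sym : ∀ {x y} → G x y → G y x
  G-sym = balanced-sym T q
  G-irrefl : ∀ {x} → ¬ G x x
  G-irrefl = balanced-irrefl T q
  t′ : Growth G u v L
  t′ = rebalance T t q (λ _ → refl)
  Guv : G u v
  Guv = root-balanced T Auv t q (λ _ → refl)
  lift : ∀ p → Prime p → suc (Assembly.size κ G G-sym G-irrefl u v Guv κu κv t′ + (Strands.Λ κ + Strands.Λ κ)) ≤ p → Hamiltonian (LiftAdj T p)
  lift p p-prime large = transport-hamiltonian gauge gauge-injective gauge-surjective (gauge-adjacent κ loop≡)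
    (TrivialVoltages.hamiltonian κ G G-sym G-irrefl u v Guv κu κv t′ complete p p-prime large)
    where
    instance
      p-nonZero : NonZero p
      p-nonZero = prime⇒nonZero p-prime
    open Gauge T q p
    loop≡ : ∀ w → loopφ w ≡ + suc (κ w)
    loop≡ w = pred-suc (positive w)
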